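{- There is a universal constant $C$ such that the following holds. Let $D$ be any (admissible) concave delay function, let $f$ be a piece-wise linear function with exponentially decreasing slopes satisfying $f(x)\le D(x)\le 2f(x)$ for all $x\ge 0$, and let BPSLA be the Bipartite-Single-Location-Algorithm run with the counters defined by $f$. Then for every instance of Single Location Concave MBPMD, the total delay cost (measured with $D$) of the matching produced by BPSLA is at most $C$ times the cost of an optimal offline solution.
   Context: Admissible delay function: $D:[0,\infty)\to[0,\infty)$ with $D(0)=0$, concave, continuous, monotonically increasing, with all one-sided derivatives positive and bounded, and $\lim_{t\to\infty}D(t)=\infty$. Single Location Concave MBPMD: finitely many requests arrive over time at a single location; request $r$ arrives at time $a(r)\ge 0$ and has a polarity, positive or negative; the numbers of positive and negative requests are equal. At any time an algorithm may irrevocably match an arrived unmatched positive request with an arrived unmatched negative request; all requests must eventually be matched. If $r$ is matched at time $m(r)\ge a(r)$ it incurs delay cost $D(m(r)-a(r))$; the cost of a solution is $\sum_r D(m(r)-a(r))$. An online algorithm's decisions at time $t$ depend only on requests arrived by time $t$. The optimal offline solution minimizes the cost knowing the whole instance. Piece-wise linear function with exponentially decreasing slopes: $f$ is continuous with $f(0)=0$, and there are $0=x_0<x_1<x_2<\dots$ such that on the $k$-th piece $[x_{k-1},x_k)$ ($k=1,2,\dots$) $f$ is linear with slope $\alpha_k>0$, where $\alpha_k\ge 2\alpha_{k+1}$; either there are finitely many pieces $k=1,\dots,d$ with $x_d=\infty$, or infinitely many with $x_k\to\infty$. Put $y_k=\alpha_k(x_k-x_{k-1})$ (possibly $y_d=\infty$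 for a last piece). Algorithm BPSLA: for each linear piece $k$ there are two counters $z_k^+$ and $z_k^-$, each with capacity $y_k$ and slope $\alpha_k$, initially at value $0$. An arriving positive (negative) request is associated with $z_1^+$ (with $z_1^-$). Whenever there are requests associated with both $z_k^+$ and $z_k^-$ for the same $k$, one from each is matched together and removed from the counters. Let $P_k(t)$ (resp. $N_k(t)$) be the number of positive (negative) requests associated with $z_k^+$ (with $z_k^-$) at time $t$, and $sur_k(t)=\sum_{i=1}^k (P_i(t)-N_i(t))$. At every time $t$, simultaneously for all $k$: $z_k^+$ (resp. $z_k^-$) increases at rate $\alpha_k|sur_k(t)|$ if and only if at least one request is associated with it and $sur_k(t)>0$ (resp. $sur_k(t)<0$); otherwise it stays constant. When $z_k^+$ (resp. $z_k^-$) reaches its capacity $y_k$, a single request associated with it is moved to $z_{k+1}^+$ (resp. $z_{k+1}^-$), and both $z_k^+$ and $z_k^-$ are reset to $0$. If a counter reaches capacity at the same instant at which a request arrives, the move is performed first. Other ties are broken arbitrarily. -}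

module Defs where

open import Algebra.Bundles using (CommutativeRing)
open import Algebra.Structures using (IsCommutativeRing)
import Algebra.Definitions.RawMonoid as RawMonoidDefinitions
import Algebra.Properties.CommutativeMonoid.Sum as CommutativeMonoidSum
open import Data.Bool.Base using (if_then_else_)
open import Data.Fin.Base using (Fin)
open import Data.Fin.Permutation using (Permutation′; _⟨$⟩ʳ_)
import Data.Fin.Properties as Fin
open import Data.Integer.Base as ℤ using (ℤ; 0ℤ; ∣_∣; _⊖_)
open import Data.Nat.Base as ℕ using (ℕ; zero; suc)
import Data.Nat.Properties as ℕ
open import Data.Product.Base using (∃; _×_; _,_)
open import Data.Product.Properties using (≡-dec)
open import Data.Sign.Base using (Sign) renaming (+ to pos; - to neg)
import Data.Sign.Properties as Sign
open import Data.Unit.Base using (⊤)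
open import Level using (0ℓ)
open import Relation.Binary.Construct.Closure.ReflexiveTransitive using (Star)
import Relation.Binary.Construct.NonStrictToStrict as NonStrictToStrict
open import Relation.Binary.Definitions using (DecidableEquality)
open import Relation.Binary.PropositionalEquality.Core using (_≡_; _≢_)
open import Relation.Binary.Structures using (IsDecTotalOrder)
open import Relation.Nullary.Decidable.Core using (does)
open import Relation.Nullary.Negation.Core using (¬_)

-- The real numbers, characterised (classically, up to unique isomorphism) as
-- the Dedekind-complete ordered field.  The value of 0# ⁻¹ is unconstrained.

record RealNumbers : Set₁ where
  infix  8 _⁻¹ -_
  infixl 7 _*_
  infixl 6 _+_
  infix  4 _≤_
  field
    ℝ       : Set
    _+_ _*_ : ℝ → ℝ → ℝ
    -_ _⁻¹  : ℝ → ℝ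
    0# 1#   : ℝ
    _≤_     : ℝ → ℝ → Set

    isCommutativeRing : IsCommutativeRing _≡_ _+_ _*_ -_ 0# 1#
    isDecTotalOrder   : IsDecTotalOrder _≡_ _≤_
    0≢1               : 0# ≢ 1#
    ⁻¹-inverseʳ       : ∀ {x} → x ≢ 0# → x * x ⁻¹ ≡ 1#
    +-monoʳ-≤         : ∀ x {y z} → y ≤ z → x + y ≤ x + z
    *-nonNeg          : ∀ {x y} → 0# ≤ x → 0# ≤ y → 0# ≤ x * y
    sup               : (P : ℝ → Set) → ∃ P →
                        (∃ λ b → ∀ x → P x → x ≤ b) →
                        ∃ λ s → (∀ x → P x → x ≤ s) ×
                                (∀ b → (∀ x → P x → x ≤ b) → s ≤ b)

  commutativeRing : CommutativeRing 0ℓ 0ℓ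
  commutativeRing = record { isCommutativeRing = isCommutativeRing }

  open CommutativeRing commutativeRing public
    using (_-_; +-rawMonoid; +-commutativeMonoid)

  open NonStrictToStrict _≡_ _≤_ public using (_<_)

  open CommutativeMonoidSum +-commutativeMonoid public using (sum)

  fromℕ : ℕ → ℝ
  fromℕ n = RawMonoidDefinitions._×_ +-rawMonoid n 1#

  2# : ℝ
  2# = 1# + 1#

module Concave (R : RealNumbers) where
  open RealNumbers R

  -- Functions on [0,∞) are represented by functions ℝ → ℝ of which only the
  -- values at nonnegative arguments matter.

  Within : ℝ → ℝ → ℝ → Set
  Within ε u v = (u < v + ε) × (v < u + ε)

  Continuous : (ℝ → ℝ) → Set
  Continuous g = ∀ t → 0# ≤ t → ∀ ε → 0# < ε →
    ∃ λ δ → 0# < δ × (∀ u → 0# ≤ u → Within δ t u → Within ε (g t) (g u))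

  RightDerivative : (ℝ → ℝ) → ℝ → ℝ → Set
  RightDerivative g t L = ∀ ε → 0# < ε →
    ∃ λ δ → 0# < δ ×
      (∀ h → 0# < h → h < δ → Within ε ((g (t + h) - g t) * h ⁻¹) L)

  LeftDerivative : (ℝ → ℝ) → ℝ → ℝ → Set
  LeftDerivative g t L = ∀ ε → 0# < ε →
    ∃ λ δ → 0# < δ ×
      (∀ h → 0# < h → h < δ → h ≤ t → Within ε ((g t - g (t - h)) * h ⁻¹) L)

  record Admissible (D : ℝ → ℝ) : Set where
    field
      nonNeg     : ∀ t → 0# ≤ t → 0# ≤ D t
      atZero     : D 0# ≡ 0#
      concave    : ∀ s t w → 0# ≤ s → 0# ≤ t → 0# ≤ w → w ≤ 1# →
                   w * D s + (1# - w) * D t ≤ D (w * s + (1# - w) * t)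
      continuous : Continuous D
      monotone   : ∀ s t → 0# ≤ s → s ≤ t → D s ≤ D t
      slopeBound : ℝ
      rightSlope : ∀ t → 0# ≤ t →
                   ∃ λ L → RightDerivative D t L × 0# < L × L ≤ slopeBound
      leftSlope  : ∀ t → 0# < t →
                   ∃ λ L → LeftDerivative D t L × 0# < L × L ≤ slopeBound
      unbounded  : ∀ M → ∃ λ T → ∀ t → 0# ≤ t → T ≤ t → M ≤ D t

  -- Pieces are numbered from 0: piece k is [x k , x (suc k)) with slope α k,
  -- except that the last piece, if there is one, is [x k , ∞).

  data Extent : Set where
    lastPiece : ℕ → Extent
    unending  : Extent

  IsPiece : Extent → ℕ → Set
  IsPiece (lastPiece ℓ) k = k ℕ.≤ ℓ
  IsPiece unending      k = ⊤

  HasNext : Extent → ℕ → Set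
  HasNext (lastPiece ℓ) k = k ℕ.< ℓ
  HasNext unending      k = ⊤

  record ExpPiecewiseLinear : Set where
    field
      f      : ℝ → ℝ
      extent : Extent
      x      : ℕ → ℝ
      α      : ℕ → ℝ

    InPiece : ℕ → ℝ → Set
    InPiece k t = x k ≤ t × (HasNext extent k → t < x (suc k))

    field
      f-zero       : f 0# ≡ 0#
      f-continuous : Continuous f
      f-linear     : ∀ k → IsPiece extent k → ∀ s t → InPiece k s → InPiece k t →
                     f t - f s ≡ α k * (t - s)
      x-zero       : x 0 ≡ 0#
      x-increasing : ∀ k → HasNext extent k → x k < x (suc k)
      x-unbounded  : extent ≡ unending → ∀ M → ∃ λ K → ∀ k → K ℕ.≤ k → M ≤ x k
      α-positive   : ∀ k → IsPiece extent k → 0# < α k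
      α-halving    : ∀ k → HasNext extent k → 2# * α (suc k) ≤ α k

    -- Meaningful only if HasNext extent k; the capacity of a last piece is ∞.
    y : ℕ → ℝ
    y k = α k * (x (suc k) - x k)

  -- m positive and m negative requests.

  record Instance : Set where
    field
      m : ℕ

    Request : Set
    Request = Sign × Fin m

    field
      arrival        : Request → ℝ
      arrival-nonNeg : ∀ r → 0# ≤ arrival r

    _≟ᵣ_ : DecidableEquality Request
    _≟ᵣ_ = ≡-dec Sign._≟_ Fin._≟_

  module _ (I : Instance) where
    open Instance I

    record Solution : Set where
      field
        partner  : Permutation′ m
        time     : Request → ℝ
        together : ∀ i → time (pos , i) ≡ time (neg , partner ⟨$⟩ʳ i)
        causal   : ∀ r → arrival r ≤ time r

    cost : (ℝ → ℝ) → Solution → ℝ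
    cost D S = sum (λ i → delay (pos , i)) + sum (λ i → delay (neg , i))
      where
      open Solution S
      delay : Request → ℝ
      delay r = D (time r - arrival r)

    Optimal : (ℝ → ℝ) → Solution → Set
    Optimal D S = ∀ S′ → cost D S ≤ cost D S′

  module BPSLA (F : ExpPiecewiseLinear) (I : Instance) where
    open ExpPiecewiseLinear F
    open Instance I

    -- A request is unarrived, associated with the counter of its own polarity
    -- on piece k, or matched with request j of the other polarity at time t.

    data Status : Set where
      unarrived : Status
      on        : (k : ℕ) → Status
      matched   : (j : Fin m) (t : ℝ) → Status

    record State : Set where
      constructor ⟨_,_,_⟩
      field
        now     : ℝ
        status  : Request → Status
        counter : Sign → ℕ → ℝ

    open State

    initial : State
    initial = ⟨ 0# , (λ _ → unarrived) , (λ _ _ → 0#) ⟩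

    _[_≔_] : (Request → Status) → Request → Status → Request → Status
    (σ [ r ≔ v ]) r′ = if does (r′ ≟ᵣ r) then v else σ r′

    reset : ℕ → (Sign → ℕ → ℝ) → Sign → ℕ → ℝ
    reset k z p k′ = if does (k′ ℕ.≟ k) then 0# else z p k′

    indicator : ℕ → Status → ℕ
    indicator k (on k′) = if does (k′ ℕ.≟ k) then 1 else 0
    indicator k _       = 0

    number : State → Sign → ℕ → ℕ
    number s p k =
      CommutativeMonoidSum.sum ℕ.+-0-commutativeMonoid
        (λ i → indicator k (status s (p , i)))

    surplus : State → ℕ → ℤ
    surplus s zero    = number s pos zero ⊖ number s neg zero
    surplus s (suc k) = surplus s k ℤ.+ (number s pos (suc k) ⊖ number s neg (suc k))

    InSurplus : Sign → ℤ → Set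
    InSurplus pos n = 0ℤ ℤ.< n
    InSurplus neg n = n ℤ.< 0ℤ

    Increasing : State → Sign → ℕ → Set
    Increasing s p k = (∃ λ i → status s (p , i) ≡ on k) × InSurplus p (surplus s k)

    Full : State → Sign → ℕ → Set
    Full s p k = HasNext extent k × counter s p k ≡ y k

    NoPair : State → Set
    NoPair s = ∀ k i j → ¬ (status s (pos , i) ≡ on k × status s (neg , j) ≡ on k)

    NoneFull : State → Set
    NoneFull s = ∀ p k → ¬ Full s p k

    -- Matching takes precedence over moves, moves over arrivals, and all three
    -- over the passage of time; any other choice is left open.  While time
    -- passes without a discrete event the surpluses are constant, so the
    -- counters grow linearly.

    infix 4 _⟶_

    data _⟶_ (s : State) : State → Set where

      match : ∀ {i j} k →
              status s (pos , i) ≡ on k →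
              status s (neg , j) ≡ on k →
              s ⟶ ⟨ now s
                  , status s [ pos , i ≔ matched j (now s) ] [ neg , j ≔ matched i (now s) ]
                  , counter s ⟩

      move : ∀ {p i} k →
             NoPair s →
             Full s p k →
             status s (p , i) ≡ on k →
             s ⟶ ⟨ now s , status s [ p , i ≔ on (suc k) ] , reset k (counter s) ⟩

      arrive : ∀ {r} →
               NoPair s →
               NoneFull s →
               status s r ≡ unarrived →
               arrival r ≡ now s →
               s ⟶ ⟨ now s , status s [ r ≔ on 0 ] , counter s ⟩

      elapse : ∀ δ (z : Sign → ℕ → ℝ) →
               NoPair s →
               NoneFull s →
               0# < δ →
               (∀ r → status s r ≡ unarrived → now s + δ ≤ arrival r) →
               (∀ p k → Increasing s p k →
                  z p k ≡ counter s p k + α k * fromℕ ∣ surplus s k ∣ * δ) →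
               (∀ p k → ¬ Increasing s p k → z p k ≡ counter s p k) →
               (∀ p k → HasNext extent k → z p k ≤ y k) →
               s ⟶ ⟨ now s + δ , status s , z ⟩

    -- S is the outcome of some run of the algorithm.

    Produces : Solution I → Set
    Produces S = ∃ λ s → Star _⟶_ initial s ×
      (∀ i → status s (pos , i) ≡ matched (partner ⟨$⟩ʳ i) (time (pos , i))) ×
      (∀ i → status s (neg , partner ⟨$⟩ʳ i) ≡ matched i (time (neg , partner ⟨$⟩ʳ i)))
      where open Solution S

{-# OPTIONS --safe #-}

-- Fix a level k and compare the surplus of the algorithm up to level k with the
-- surplus of a reference solution that pairs requests as OPT does and drops, on
-- arrival, both requests of every pair whose arrival times lie at least
-- x (suc k) apart.  Keeping a pair costs α k times its gap and dropping it
-- costs y k; over all levels this sums to at most 3 f(gap), by the geometric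
-- decrease of the slopes.  The offset between the two surpluses changes only
-- when the algorithm moves a request away from level k or the reference drops
-- one.  A counter that grows while its polarity has a positive offset is paid
-- for by a potential proportional to the offset, and otherwise the reference
-- surplus is at least as large and pays.  Counter growth in turn dominates the
-- delay of the algorithm: at most y k per move, and, because the slopes halve,
-- a constant multiple of the rate Σ α k (P k + N k) while time passes.

module Submission where

open import Defs
open import Algebra.Bundles using (CommutativeMonoid; CommutativeRing)
import Algebra.Construct.NaturalChoice.Max as NaturalMax
import Algebra.Construct.NaturalChoice.Min as NaturalMin
import Algebra.Properties.CommutativeMonoid.Sum as CommutativeMonoidSum
import Algebra.Properties.Monoid.Mult as MonoidMult
import Algebra.Properties.Semiring.Mult as SemiringMult
import Algebra.Solver.Ring as RingSolver
import Algebra.Solver.Ring.AlmostCommutativeRing as ACR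
open import Data.Bool.Base using (Bool; true; false; if_then_else_)
open import Data.Fin.Base using (Fin; zero; suc)
open import Data.Fin.Permutation using (Permutation′; _⟨$⟩ʳ_; _⟨$⟩ˡ_; inverseˡ; inverseʳ)
import Data.Fin.Properties as Fin
open import Data.Integer.Base as ℤ using (ℤ; -[1+_]; ∣_∣; _⊖_; 0ℤ; 1ℤ)
import Data.Integer.Properties as ℤ
open import Data.Integer.Solver using (module +-*-Solver)
open import Data.Maybe.Base using (just; nothing)
open import Data.Nat.Base as ℕ using (ℕ; zero; suc)
import Data.Nat.Properties as ℕ
open import Data.Product.Base using (∃; _×_; _,_; proj₁; proj₂)
open import Data.Sign.Base using (Sign) renaming (+ to pos; - to neg)
open import Data.Sum.Base using (_⊎_; inj₁; inj₂)
open import Data.Unit.Base using (tt)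
open import Function.Base using (_∘_; id)
open import Function.Bundles using (mk⇔)
open import Level using (Level; 0ℓ)
open import Relation.Binary.Bundles using (DecTotalOrder)
open import Relation.Binary.Construct.Closure.ReflexiveTransitive using (Star; _◅_)
import Relation.Binary.Construct.NonStrictToStrict as NonStrictToStrict
open import Relation.Binary.Definitions using (WeaklyDecidable; tri<; tri≈; tri>)
open import Relation.Binary.PropositionalEquality
  using (_≡_; _≢_; refl; sym; trans; cong; cong₂; subst; subst₂; module ≡-Reasoning)
open import Relation.Nullary using (¬_; Dec; yes; no; contradiction; does)
open import Relation.Nullary.Decidable using (dec-true; dec-false; does-⇔; _×-dec_)

-- Long pairs are dropped because the costs of all levels together must stay within a multiple of
-- `f`: a pair of gap `g` that is kept everywhere costs `α 0 * g` at level 0 alone, which can exceed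
-- `f g` by any factor. The threshold `x (suc k)` is the end of piece `k`, so a pair dropped at
-- level `k` costs `y k`, no more than what `f` has gained on that piece.
--
-- The offset is insensitive to the other events: a match takes one request of each polarity from
-- the same level, and the arrival of a kept request changes both surpluses alike.
--
-- The final constant is 84 = 2 · 3 · 14. A drop raises the potential of a level by at most 7 `y k`,
-- and a long pair drops two requests, hence 14. A kept pair could be charged at rate 8 + 3 = 11; it
-- is charged 14 so that both kinds of pair have the same factor. The sum over the levels
-- contributes 3, and `D ≤ 2 f` contributes 2.

module _ {c ℓ : Level} (M : CommutativeMonoid c ℓ) where
  open CommutativeMonoid M
  open CommutativeMonoidSum M using (sum)
  open import Relation.Binary.Reasoning.Setoid setoid

  -- Adding the changed entries crosswise avoids subtraction, so one proof serves both real and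
  -- integer sums.
  sum-update : ∀ {n} (f g : Fin n → Carrier) i → (∀ j → j ≢ i → f j ≈ g j) →
               sum f ∙ g i ≈ sum g ∙ f i
  sum-update {suc n} f g zero eq = begin
    (f zero ∙ sum (f ∘ suc)) ∙ g zero  ≈⟨ ∙-congʳ (∙-congˡ (tails≈ n (λ j → eq (suc j) λ ()))) ⟩
    (f zero ∙ sum (g ∘ suc)) ∙ g zero  ≈⟨ comm _ _ ⟩
    g zero ∙ (f zero ∙ sum (g ∘ suc))  ≈⟨ ∙-congˡ (comm _ _) ⟩
    g zero ∙ (sum (g ∘ suc) ∙ f zero)  ≈⟨ assoc _ _ _ ⟨
    (g zero ∙ sum (g ∘ suc)) ∙ f zero  ∎
    where
    tails≈ : ∀ n {f g : Fin n → Carrier} → (∀ j → f j ≈ g j) → sum f ≈ sum g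
    tails≈ n = CommutativeMonoidSum.sum-cong-≋ M
  sum-update {suc n} f g (suc i) eq = begin
    (f zero ∙ sum (f ∘ suc)) ∙ g (suc i)  ≈⟨ assoc _ _ _ ⟩
    f zero ∙ (sum (f ∘ suc) ∙ g (suc i))  ≈⟨ ∙-cong (eq zero λ ()) (sum-update (f ∘ suc) (g ∘ suc) i
                                               (λ j j≢i → eq (suc j) (j≢i ∘ Fin.suc-injective))) ⟩
    g zero ∙ (sum (g ∘ suc) ∙ f (suc i))  ≈⟨ assoc _ _ _ ⟨
    (g zero ∙ sum (g ∘ suc)) ∙ f (suc i)  ∎

-- Ordered field arithmetic and a ring solver with integer coefficients.

module Real (R : RealNumbers) where
  open RealNumbers R hiding (sum)
  open CommutativeRing commutativeRing public
    using (+-identityˡ; +-identityʳ; +-comm; +-assoc; -‿inverseʳ; zeroʳ; semiring; +-monoid; distribˡ;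
           *-comm; *-assoc; *-identityˡ; *-identityʳ)

  ≤-decTotalOrder : DecTotalOrder 0ℓ 0ℓ 0ℓ
  ≤-decTotalOrder = record { isDecTotalOrder = isDecTotalOrder }

  open DecTotalOrder ≤-decTotalOrder public
    using (totalOrder; _≤?_; _≟_)
    renaming (refl to ≤-refl; reflexive to ≤-reflexive; trans to ≤-trans; antisym to ≤-antisym; total to ≤-total)

  open NonStrictToStrict _≡_ _≤_ public using (<⇒≤)

  ≰⇒> : ∀ {x y} → ¬ x ≤ y → y < x
  ≰⇒> = NonStrictToStrict.≰⇒> _≡_ _≤_ sym ≤-reflexive ≤-total

  <⇒≱ : ∀ {x y} → x < y → ¬ y ≤ x
  <⇒≱ = NonStrictToStrict.<⇒≱ _≡_ _≤_ ≤-antisym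

  <-≤-trans : ∀ {x y z} → x < y → y ≤ z → x < z
  <-≤-trans = NonStrictToStrict.<-≤-trans _≡_ _≤_ sym ≤-trans ≤-antisym (λ { refl → id })

  open NaturalMin totalOrder public using (_⊓_; x≤y⇒x⊓y≈x; x≤y⇒y⊓x≈x; x⊓y≤x; x⊓y≤y; ⊓-sel)
  open NaturalMax totalOrder public using (_⊔_; ⊔-comm; ⊔-lub; x≤x⊔y; x≤y⊔x; x≤y⇒x⊔y≈y)

  -- Abstract reals do not compute, so the solver takes its coefficients in ℤ, where equality is
  -- decidable, and interprets them by `ι`. A literal `κ n` then evaluates definitionally to
  -- `fromℕ n`, which is why constants are written with `fromℕ` throughout.
  ι : ℤ → ℝ
  ι (ℤ.+ n)    = fromℕ n
  ι -[1+ n ] = - fromℕ (suc n)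

  module _ where
    open import Algebra.Properties.Ring (CommutativeRing.ring commutativeRing)
      using (-0#≈0#; -‿involutive; -‿distribˡ-*; -‿+-comm)
    open ≡-Reasoning

    fromℕ-+ : ∀ m n → fromℕ (m ℕ.+ n) ≡ fromℕ m + fromℕ n
    fromℕ-+ m n = MonoidMult.×-homo-+ +-monoid 1# m n

    ι-neg : ∀ i → ι (ℤ.- i) ≡ - ι i
    ι-neg (ℤ.+ zero)  = sym -0#≈0#
    ι-neg (ℤ.+ suc n) = refl
    ι-neg -[1+ n ]  = sym (-‿involutive _)

    private
      cancel : ∀ u a b → (u + a) - (u + b) ≡ a - b
      cancel u a b = begin
        (u + a) - (u + b)          ≡⟨ cong ((u + a) +_) (-‿+-comm u b) ⟨
        (u + a) + (- u + - b)      ≡⟨ cong (_+ (- u + - b)) (+-comm u a) ⟩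
        (a + u) + (- u + - b)      ≡⟨ +-assoc a u _ ⟩
        a + (u + (- u + - b))      ≡⟨ cong (a +_) (sym (+-assoc u _ _)) ⟩
        a + ((u - u) + - b)        ≡⟨ cong (λ v → a + (v + - b)) (-‿inverseʳ u) ⟩
        a + (0# + - b)             ≡⟨ cong (a +_) (+-identityˡ _) ⟩
        a - b                      ∎

    ι-⊖ : ∀ m n → ι (m ⊖ n) ≡ fromℕ m - fromℕ n
    ι-⊖ m       zero    = sym (trans (cong (fromℕ m +_) -0#≈0#) (+-identityʳ _))
    ι-⊖ zero    (suc n) = sym (+-identityˡ _)
    ι-⊖ (suc m) (suc n) = begin
      ι (suc m ⊖ suc n)              ≡⟨ cong ι (ℤ.[1+m]⊖[1+n]≡m⊖n m n) ⟩
      ι (m ⊖ n)                      ≡⟨ ι-⊖ m n ⟩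
      fromℕ m - fromℕ n              ≡⟨ cancel 1# _ _ ⟨
      fromℕ (suc m) - fromℕ (suc n)  ∎

    ι-+ : ∀ i j → ι (i ℤ.+ j) ≡ ι i + ι j
    ι-+ (ℤ.+ m)    (ℤ.+ n)    = fromℕ-+ m n
    ι-+ (ℤ.+ m)    -[1+ n ] = ι-⊖ m (suc n)
    ι-+ -[1+ m ] (ℤ.+ n)    = trans (ι-⊖ n (suc m)) (+-comm _ _)
    ι-+ -[1+ m ] -[1+ n ] = begin
      - fromℕ (suc (suc (m ℕ.+ n)))       ≡⟨ cong (λ v → - fromℕ v) (ℕ.+-suc (suc m) n) ⟨
      - fromℕ (suc m ℕ.+ suc n)           ≡⟨ cong -_ (fromℕ-+ (suc m) (suc n)) ⟩
      - (fromℕ (suc m) + fromℕ (suc n))   ≡⟨ -‿+-comm _ _ ⟨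
      - fromℕ (suc m) + - fromℕ (suc n)   ∎

    private
      ι-*₊₊ : ∀ m n → ι (ℤ.+ m ℤ.* ℤ.+ n) ≡ fromℕ m * fromℕ n
      ι-*₊₊ m n = trans (cong ι (sym (ℤ.pos-* m n))) (SemiringMult.×1-homo-* semiring m n)

      ι-*₊ : ∀ m j → ι (ℤ.+ m ℤ.* j) ≡ fromℕ m * ι j
      ι-*₊ m (ℤ.+ n)    = ι-*₊₊ m n
      ι-*₊ m -[1+ n ] = begin
        ι (ℤ.+ m ℤ.* ℤ.- (ℤ.+ suc n))    ≡⟨ cong ι (ℤ.neg-distribʳ-* (ℤ.+ m) (ℤ.+ suc n)) ⟨
        ι (ℤ.- (ℤ.+ m ℤ.* ℤ.+ suc n))    ≡⟨ ι-neg (ℤ.+ m ℤ.* ℤ.+ suc n) ⟩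
        - ι (ℤ.+ m ℤ.* ℤ.+ suc n)        ≡⟨ cong -_ (ι-*₊₊ m (suc n)) ⟩
        - (fromℕ m * fromℕ (suc n))  ≡⟨ cong -_ (*-comm _ _) ⟩
        - (fromℕ (suc n) * fromℕ m)  ≡⟨ -‿distribˡ-* _ _ ⟩
        - fromℕ (suc n) * fromℕ m    ≡⟨ *-comm _ _ ⟩
        fromℕ m * - fromℕ (suc n)    ∎

    ι-* : ∀ i j → ι (i ℤ.* j) ≡ ι i * ι j
    ι-* (ℤ.+ m)    j = ι-*₊ m j
    ι-* -[1+ m ] j = begin
      ι (ℤ.- (ℤ.+ suc m) ℤ.* j)    ≡⟨ cong ι (ℤ.neg-distribˡ-* (ℤ.+ suc m) j) ⟨
      ι (ℤ.- (ℤ.+ suc m ℤ.* j))    ≡⟨ ι-neg (ℤ.+ suc m ℤ.* j) ⟩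
      - ι (ℤ.+ suc m ℤ.* j)        ≡⟨ cong -_ (ι-*₊ (suc m) j) ⟩
      - (fromℕ (suc m) * ι j)    ≡⟨ -‿distribˡ-* _ _ ⟩
      - fromℕ (suc m) * ι j      ∎

  ι-morphism : CommutativeRing.rawRing ℤ.+-*-commutativeRing ACR.-Raw-AlmostCommutative⟶ ACR.fromCommutativeRing commutativeRing
  ι-morphism = record
    { ⟦_⟧    = ι
    ; +-homo = ι-+
    ; *-homo = ι-*
    ; -‿homo = ι-neg
    ; 0-homo = refl
    ; 1-homo = +-identityʳ 1#
    }

  ι≟ : WeaklyDecidable (ACR.Induced-equivalence ι-morphism)
  ι≟ i j with i ℤ.≟ j
  ... | yes i≡j = just (cong ι i≡j)
  ... | no  _   = nothing

  module Solver = RingSolver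
    (CommutativeRing.rawRing ℤ.+-*-commutativeRing)
    (ACR.fromCommutativeRing commutativeRing)
    ι-morphism ι≟
  open Solver public using (solve; _:=_; _:+_; _:*_; _:-_; :-_; con; Polynomial)

  κ : ∀ {n} → ℕ → Polynomial n
  κ n = con (ℤ.+ n)

  -- An inequality follows from another one with the same difference of sides;
  -- the equation of differences is left to the ring solver.
  ≤-by : ∀ {a b x y} → a ≤ b → y - x ≡ b - a → x ≤ y
  ≤-by {a} {b} {x} {y} a≤b eq = subst (_≤ y) left (subst (x - a + a ≤_) right (+-monoʳ-≤ (x - a) a≤b))
    where
    left : x - a + a ≡ x
    left = solve 2 (λ x a → x :- a :+ a := x) refl x a
    right : x - a + b ≡ y
    right = trans (solve 3 (λ x a b → x :- a :+ b := x :+ (b :- a)) refl x a b)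
           (trans (cong (x +_) (sym eq)) (solve 2 (λ x y → x :+ (y :- x) := y) refl x y))

  +-mono-≤ : ∀ {a b x y} → a ≤ b → x ≤ y → a + x ≤ b + y
  +-mono-≤ {a} {b} {x} {y} a≤b x≤y = ≤-trans (+-monoʳ-≤ a x≤y)
    (≤-by a≤b (solve 3 (λ a b y → (b :+ y) :- (a :+ y) := b :- a) refl a b y))

  0≤⇒≤ : ∀ {x y} → 0# ≤ y - x → x ≤ y
  0≤⇒≤ {x} {y} 0≤ = ≤-by 0≤ (solve 1 (λ d → d := d :- κ 0) refl (y - x))

  ≤⇒0≤ : ∀ {x y} → x ≤ y → 0# ≤ y - x
  ≤⇒0≤ {x} {y} x≤y = ≤-by x≤y (solve 1 (λ d → d :- κ 0 := d) refl (y - x))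

  *-monoˡ-≤ : ∀ {c x y} → 0# ≤ c → x ≤ y → c * x ≤ c * y
  *-monoˡ-≤ {c} {x} {y} 0≤c x≤y = 0≤⇒≤ (subst (0# ≤_)
    (solve 3 (λ c x y → c :* (y :- x) := c :* y :- c :* x) refl c x y)
    (*-nonNeg 0≤c (≤⇒0≤ x≤y)))

  *-monoʳ-≤ : ∀ {c x y} → 0# ≤ c → x ≤ y → x * c ≤ y * c
  *-monoʳ-≤ {c} {x} {y} 0≤c x≤y = 0≤⇒≤ (subst (0# ≤_)
    (solve 3 (λ c x y → c :* (y :- x) := y :* c :- x :* c) refl c x y)
    (*-nonNeg 0≤c (≤⇒0≤ x≤y)))

  +-nonNeg : ∀ {x y} → 0# ≤ x → 0# ≤ y → 0# ≤ x + y
  +-nonNeg 0≤x 0≤y = subst (_≤ _) (+-identityˡ 0#) (+-mono-≤ 0≤x 0≤y)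

  0≤1 : 0# ≤ 1#
  0≤1 with ≤-total 0# 1#
  ... | inj₁ p = p
  ... | inj₂ p = subst (0# ≤_) (trans (solve 1 (λ u → :- u :* :- u := u :* u) refl 1#) (*-identityˡ 1#))
                   (*-nonNeg 0≤-1 0≤-1)
    where
    0≤-1 : 0# ≤ - 1#
    0≤-1 = ≤-by p (solve 1 (λ u → :- u :- κ 0 := κ 0 :- u) refl 1#)

  0≤fromℕ : ∀ n → 0# ≤ fromℕ n
  0≤fromℕ zero    = ≤-refl
  0≤fromℕ (suc n) = +-nonNeg 0≤1 (0≤fromℕ n)

  fromℕ-mono-≤ : ∀ {m n} → m ℕ.≤ n → fromℕ m ≤ fromℕ n
  fromℕ-mono-≤ {n = n} ℕ.z≤n = 0≤fromℕ n
  fromℕ-mono-≤ (ℕ.s≤s m≤n)   = +-monoʳ-≤ 1# (fromℕ-mono-≤ m≤n)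

  2#≡fromℕ2 : 2# ≡ fromℕ 2
  2#≡fromℕ2 = cong (1# +_) (sym (+-identityʳ 1#))

  0<2# : 0# < 2#
  0<2# = +-nonNeg 0≤1 0≤1 , λ 0≡2 → 0≢1 (≤-antisym 0≤1
    (≤-by (+-mono-≤ (≤-reflexive (sym 0≡2)) 0≤1)
      (solve 1 (λ u → κ 0 :- u := κ 0 :+ u :- ((u :+ u) :+ κ 0)) refl 1#)))

  0<x⇒x≢0 : ∀ {x} → 0# < x → x ≢ 0#
  0<x⇒x≢0 (_ , 0≢x) x≡0 = 0≢x (sym x≡0)

  0<⁻¹ : ∀ {x} → 0# < x → 0# < x ⁻¹
  0<⁻¹ {x} 0<x = ≰⇒> λ x⁻¹≤0 → <⇒≱ (0≤1 , 0≢1)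
    (subst (_≤ 0#) (⁻¹-inverseʳ (0<x⇒x≢0 0<x))
      (subst (x * x ⁻¹ ≤_) (zeroʳ x) (*-monoˡ-≤ (<⇒≤ 0<x) x⁻¹≤0)))

  *-pos : ∀ {x y} → 0# < x → 0# < y → 0# < x * y
  *-pos {x} {y} 0<x 0<y = *-nonNeg (<⇒≤ 0<x) (<⇒≤ 0<y) , λ 0≡xy → 0<x⇒x≢0 0<y (begin
    y                 ≡⟨ *-identityˡ y ⟨
    1# * y            ≡⟨ cong (_* y) (trans (*-comm _ _) (⁻¹-inverseʳ (0<x⇒x≢0 0<x))) ⟨
    x ⁻¹ * x * y      ≡⟨ *-assoc _ _ _ ⟩
    x ⁻¹ * (x * y)    ≡⟨ cong (x ⁻¹ *_) 0≡xy ⟨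
    x ⁻¹ * 0#         ≡⟨ zeroʳ _ ⟩
    0#                ∎)
    where open ≡-Reasoning

  half : ℝ → ℝ
  half x = x * 2# ⁻¹

  half+half : ∀ x → half x + half x ≡ x
  half+half x = begin
    half x + half x    ≡⟨ solve 3 (λ x h u → x :* h :+ x :* h := x :* (h :* κ 2)) refl x (2# ⁻¹) 2# ⟩
    x * (2# ⁻¹ * fromℕ 2) ≡⟨ cong (λ v → x * (2# ⁻¹ * v)) 2#≡fromℕ2 ⟨
    x * (2# ⁻¹ * 2#)   ≡⟨ cong (x *_) (trans (*-comm _ _) (⁻¹-inverseʳ (0<x⇒x≢0 0<2#))) ⟩
    x * 1#             ≡⟨ *-identityʳ x ⟩
    x                  ∎
    where open ≡-Reasoning

  0<half : ∀ {x} → 0# < x → 0# < half x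
  0<half 0<x = *-pos 0<x (0<⁻¹ 0<2#)

  half<id : ∀ {x} → 0# < x → half x < x
  half<id {x} 0<x = ≤-by (<⇒≤ h) (trans (cong (_- half x) (sym (half+half x)))
                      (solve 1 (λ h → (h :+ h) :- h := h :- κ 0) refl (half x)))
                  , λ eq → proj₂ h (trans (solve 1 (λ h → κ 0 := h :- h) refl (half x))
                      (trans (cong (_- half x) (trans eq (sym (half+half x)))) (solve 1 (λ h → (h :+ h) :- h := h) refl (half x))))
    where h = 0<half 0<x

  ≤-from-approx : ∀ {x y} → (∀ ε → 0# < ε → x ≤ y + ε) → x ≤ y
  ≤-from-approx {x} {y} approx with x ≤? y
  ... | yes x≤y = x≤y
  ... | no  x≰y = contradiction
    (≤-by (approx (half (x - y)) (0<half 0<x-y))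
        (solve 3 (λ x y h → h :- (x :- y) := (y :+ h) :- x) refl x y (half (x - y))))
      (<⇒≱ (half<id 0<x-y))
    where
    0<x-y : 0# < x - y
    0<x-y = ≤⇒0≤ (<⇒≤ (≰⇒> x≰y)) , λ 0≡ → x≰y (≤-by (≤-reflexive (sym 0≡))
      (solve 2 (λ x y → y :- x := κ 0 :- (x :- y)) refl x y))

-- Finite sums over levels and over requests.

module Sums (R : RealNumbers) where
  open RealNumbers R
  open Real R

  Σ< : ℕ → (ℕ → ℝ) → ℝ
  Σ< zero    g = 0#
  Σ< (suc n) g = Σ< n g + g n

  Σ<-mono : ∀ n {g h} → (∀ k → k ℕ.< n → g k ≤ h k) → Σ< n g ≤ Σ< n h
  Σ<-mono zero    g≤h = ≤-refl
  Σ<-mono (suc n) g≤h = +-mono-≤ (Σ<-mono n (λ k k<n → g≤h k (ℕ.m≤n⇒m≤1+n k<n))) (g≤h n (ℕ.n<1+n n))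

  Σ<-cong : ∀ n {g h} → (∀ k → k ℕ.< n → g k ≡ h k) → Σ< n g ≡ Σ< n h
  Σ<-cong zero    g≡h = refl
  Σ<-cong (suc n) g≡h = cong₂ _+_ (Σ<-cong n (λ k k<n → g≡h k (ℕ.m≤n⇒m≤1+n k<n))) (g≡h n (ℕ.n<1+n n))

  Σ<-zero : ∀ n {g} → (∀ k → k ℕ.< n → g k ≡ 0#) → Σ< n g ≡ 0#
  Σ<-zero zero    g≡0 = refl
  Σ<-zero (suc n) g≡0 = trans (cong₂ _+_ (Σ<-zero n (λ k k<n → g≡0 k (ℕ.m≤n⇒m≤1+n k<n))) (g≡0 n (ℕ.n<1+n n))) (+-identityˡ 0#)

  Σ<-distrib-+ : ∀ n g h → Σ< n (λ k → g k + h k) ≡ Σ< n g + Σ< n h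
  Σ<-distrib-+ zero    g h = sym (+-identityˡ 0#)
  Σ<-distrib-+ (suc n) g h = trans (cong (_+ (g n + h n)) (Σ<-distrib-+ n g h))
    (solve 4 (λ a b c d → (a :+ b) :+ (c :+ d) := (a :+ c) :+ (b :+ d)) refl (Σ< n g) (Σ< n h) (g n) (h n))

  *-distribˡ-Σ< : ∀ c n g → c * Σ< n g ≡ Σ< n (λ k → c * g k)
  *-distribˡ-Σ< c zero    g = zeroʳ c
  *-distribˡ-Σ< c (suc n) g = trans (distribˡ c _ _) (cong (_+ c * g n) (*-distribˡ-Σ< c n g))

  sum-mono : ∀ {n} {g h : Fin n → ℝ} → (∀ i → g i ≤ h i) → sum g ≤ sum h
  sum-mono {zero}  g≤h = ≤-refl
  sum-mono {suc n} g≤h = +-mono-≤ (g≤h zero) (sum-mono (g≤h ∘ suc))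

  sum-cong : ∀ {n} {g h : Fin n → ℝ} → (∀ i → g i ≡ h i) → sum g ≡ sum h
  sum-cong = CommutativeMonoidSum.sum-cong-≗ +-commutativeMonoid

  sum-distrib-+ : ∀ {n} (g h : Fin n → ℝ) → sum (λ i → g i + h i) ≡ sum g + sum h
  sum-distrib-+ = CommutativeMonoidSum.∑-distrib-+ +-commutativeMonoid

  *-distribˡ-sum : ∀ c {n} (g : Fin n → ℝ) → c * sum g ≡ sum (λ i → c * g i)
  *-distribˡ-sum c {zero}  g = zeroʳ c
  *-distribˡ-sum c {suc n} g = trans (distribˡ c _ _) (cong (c * g zero +_) (*-distribˡ-sum c (g ∘ suc)))

  Σ<-sum-comm : ∀ n {m} (g : ℕ → Fin m → ℝ) → Σ< n (λ k → sum (g k)) ≡ sum (λ i → Σ< n (λ k → g k i))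
  Σ<-sum-comm zero    {m} g = sym (CommutativeMonoidSum.sum-replicate-zero +-commutativeMonoid m)
  Σ<-sum-comm (suc n) {m} g = trans (cong (_+ sum (g n)) (Σ<-sum-comm n g)) (sym (sum-distrib-+ _ (g n)))

-- Piecewise linear functions with halving slopes.

module PiecewiseLinear (R : RealNumbers) (F : Concave.ExpPiecewiseLinear R) where
  open RealNumbers R
  open Real R
  open Sums R
  open Concave R
  open ExpPiecewiseLinear F

  HasNext⇒IsPiece : ∀ e {k} → HasNext e k → IsPiece e k
  HasNext⇒IsPiece (lastPiece ℓ) = ℕ.<⇒≤
  HasNext⇒IsPiece unending      = id

  HasNext⇒IsPiece-suc : ∀ e {k} → HasNext e k → IsPiece e (suc k)
  HasNext⇒IsPiece-suc (lastPiece ℓ) = id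
  HasNext⇒IsPiece-suc unending      = id

  IsPiece-suc⇒HasNext : ∀ e {k} → IsPiece e (suc k) → HasNext e k
  IsPiece-suc⇒HasNext (lastPiece ℓ) = id
  IsPiece-suc⇒HasNext unending      = id

  IsPiece-mono : ∀ e {j k} → j ℕ.≤ k → IsPiece e k → IsPiece e j
  IsPiece-mono (lastPiece ℓ) = ℕ.≤-trans
  IsPiece-mono unending      = λ _ → id

  IsPiece-zero : ∀ e → IsPiece e 0
  IsPiece-zero (lastPiece ℓ) = ℕ.z≤n
  IsPiece-zero unending      = tt

  hasNext? : ∀ e k → Dec (HasNext e k)
  hasNext? (lastPiece ℓ) k = k ℕ.<? ℓ
  hasNext? unending      k = yes tt

  private
    down : ∀ {k} → IsPiece extent (suc k) → IsPiece extent k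
    down = IsPiece-mono extent (ℕ.n≤1+n _)

    next : ∀ {k} → IsPiece extent (suc k) → HasNext extent k
    next = IsPiece-suc⇒HasNext extent

  0≤α : ∀ {k} → IsPiece extent k → 0# ≤ α k
  0≤α pk = <⇒≤ (α-positive _ pk)

  0≤x : ∀ k → IsPiece extent k → 0# ≤ x k
  0≤x zero    _  = ≤-reflexive (sym x-zero)
  0≤x (suc k) pk = ≤-trans (0≤x k (down pk)) (<⇒≤ (x-increasing k (next pk)))

  x-mono : ∀ j k → j ℕ.≤ k → IsPiece extent k → x j ≤ x k
  x-mono j k j≤k pk with ℕ.m≤n⇒m<n∨m≡n j≤k
  ... | inj₂ refl = ≤-refl
  x-mono j (suc k) _ pk | inj₁ (ℕ.s≤s j≤k) =
    ≤-trans (x-mono j k j≤k (down pk)) (<⇒≤ (x-increasing k (next pk)))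

  α-double : ∀ k → IsPiece extent (suc k) → α (suc k) + α (suc k) ≤ α k
  α-double k pk = subst (_≤ α k)
    (trans (cong (_* α (suc k)) 2#≡fromℕ2) (solve 1 (λ a → κ 2 :* a := a :+ a) refl (α (suc k))))
    (α-halving k (next pk))

  α-antitone : ∀ k → IsPiece extent (suc k) → α (suc k) ≤ α k
  α-antitone k pk = ≤-trans
    (≤-by (0≤α pk) (solve 1 (λ a → (a :+ a) :- a := a :- κ 0) refl (α (suc k)))) (α-double k pk)

  0≤y : ∀ {k} → HasNext extent k → 0# ≤ y k
  0≤y hk = *-nonNeg (0≤α (HasNext⇒IsPiece extent hk)) (≤⇒0≤ (<⇒≤ (x-increasing _ hk)))

  f-on-piece : ∀ {k t} → IsPiece extent k → InPiece k t → f t ≡ f (x k) + α k * (t - x k)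
  f-on-piece {k} {t} pk t∈k = begin
    f t                      ≡⟨ solve 2 (λ u v → u := v :+ (u :- v)) refl (f t) (f (x k)) ⟩
    f (x k) + (f t - f (x k)) ≡⟨ cong (f (x k) +_) (f-linear k pk (x k) t (≤-refl , x-increasing k) t∈k) ⟩
    f (x k) + α k * (t - x k) ∎
    where open ≡-Reasoning

  -- The piece [x k , x (suc k)) excludes its right end, so the value there is
  -- a limit of values on the piece.
  f-next : ∀ k → HasNext extent k → f (x (suc k)) ≡ f (x k) + y k
  f-next k hk = ≤-antisym (≤-from-approx upper) (≤-from-approx lower)
    where
    X = x (suc k)
    pk = HasNext⇒IsPiece extent hk
    0<α = α-positive k pk

    near : ∀ ε → 0# < ε → (f X ≤ f (x k) + y k + ε) × (f (x k) + y k ≤ f X + (ε + ε))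
    near ε 0<ε with f-continuous X (0≤x (suc k) (HasNext⇒IsPiece-suc extent hk)) ε 0<ε
    ... | δ , 0<δ , close = ≤-trans (<⇒≤ (proj₁ fX~fu))
            (≤-by αη≥0 (trans (cong (λ v → f (x k) + y k + ε - (v + ε)) fu)
              (solve 6 (λ a b c α h e → ((a :+ α :* (b :- c)) :+ e) :- ((a :+ α :* ((b :- h) :- c)) :+ e) := α :* h :- κ 0)
                refl (f (x k)) X (x k) (α k) η ε)))
        , ≤-by (+-mono-≤ (<⇒≤ (proj₂ fX~fu)) αη≤ε)
            (trans (solve 7 (λ a b c α h e v → (v :+ (e :+ e)) :- (a :+ α :* (b :- c)) :=
                ((v :+ e) :+ e) :- ((a :+ α :* ((b :- h) :- c)) :+ α :* h)) refl (f (x k)) X (x k) (α k) η ε (f X))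
              (cong (λ w → f X + ε + ε - (w + α k * η)) (sym fu)))
      where
      gap = X - x k
      0<gap : 0# < gap
      0<gap = ≤⇒0≤ (<⇒≤ (x-increasing k hk)) , λ 0≡ → proj₂ (x-increasing k hk)
        (≤-antisym (<⇒≤ (x-increasing k hk))
          (≤-by (≤-reflexive (sym 0≡)) (solve 2 (λ u v → v :- u := κ 0 :- (u :- v)) refl X (x k))))
      -- The point `X - η` must be within `δ` of `X` for continuity, stay on piece `k`, and satisfy
      -- `α k * η ≤ ε`. The lower estimate therefore loses `ε` twice, once to continuity and once to
      -- `α k * η`.
      bound = (δ ⊓ gap) ⊓ (ε * α k ⁻¹)
      0<bound : 0# < bound
      0<bound with ⊓-sel (δ ⊓ gap) (ε * α k ⁻¹) | ⊓-sel δ gap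
      ... | inj₂ e | _ = subst (0# <_) (sym e) (*-pos 0<ε (0<⁻¹ 0<α))
      ... | inj₁ e | inj₁ e′ = subst (0# <_) (sym (trans e e′)) 0<δ
      ... | inj₁ e | inj₂ e′ = subst (0# <_) (sym (trans e e′)) 0<gap
      η = half bound
      0<η = 0<half 0<bound
      η<bound = half<id 0<bound
      η<δ : η < δ
      η<δ = <-≤-trans η<bound (≤-trans (x⊓y≤x (δ ⊓ gap) _) (x⊓y≤x δ gap))
      η≤gap : η ≤ gap
      η≤gap = <⇒≤ (<-≤-trans η<bound (≤-trans (x⊓y≤x (δ ⊓ gap) _) (x⊓y≤y δ gap)))
      αη≥0 : 0# ≤ α k * η
      αη≥0 = *-nonNeg (0≤α pk) (<⇒≤ 0<η)
      αη≤ε : α k * η ≤ ε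
      αη≤ε = subst (α k * η ≤_)
        (trans (solve 3 (λ a e i → a :* (e :* i) := (a :* i) :* e) refl (α k) ε (α k ⁻¹))
          (trans (cong (_* ε) (⁻¹-inverseʳ (0<x⇒x≢0 0<α))) (*-identityˡ ε)))
        (*-monoˡ-≤ (0≤α pk) (<⇒≤ (<-≤-trans η<bound (x⊓y≤y (δ ⊓ gap) _))))
      u = X - η
      x≤u : x k ≤ u
      x≤u = ≤-by η≤gap (solve 3 (λ X x h → (X :- h) :- x := (X :- x) :- h) refl X (x k) η)
      u<X : u < X
      u<X = ≤-by (<⇒≤ 0<η) (solve 2 (λ X h → X :- (X :- h) := h :- κ 0) refl X η)
          , λ e → proj₂ 0<η (trans (solve 1 (λ X → κ 0 := X :- X) refl X)
              (trans (cong (λ v → X - v) (sym e)) (solve 2 (λ X h → X :- (X :- h) := h) refl X η)))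
      u∈k : InPiece k u
      u∈k = x≤u , λ _ → u<X
      fu : f u ≡ f (x k) + α k * (u - x k)
      fu = f-on-piece pk u∈k
      0≤u = ≤-trans (0≤x k pk) x≤u
      X<u+δ : X < u + δ
      X<u+δ = ≤-by (<⇒≤ η<δ) (solve 3 (λ X h d → ((X :- h) :+ d) :- X := d :- h) refl X η δ)
          , λ e → proj₂ η<δ (trans (solve 2 (λ X h → h := X :- (X :- h)) refl X η)
              (trans (cong (_- u) e) (solve 2 (λ u d → (u :+ d) :- u := d) refl u δ)))
      u<X+δ : u < X + δ
      u<X+δ = <-≤-trans u<X (≤-by (<⇒≤ 0<δ) (solve 2 (λ X d → (X :+ d) :- X := d :- κ 0) refl X δ))
      fX~fu : Within ε (f X) (f u)
      fX~fu = close u 0≤u (X<u+δ , u<X+δ)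

    upper : ∀ ε → 0# < ε → f X ≤ f (x k) + y k + ε
    upper ε 0<ε = proj₁ (near ε 0<ε)
    lower : ∀ ε → 0# < ε → f (x k) + y k ≤ f X + ε
    lower ε 0<ε = subst (λ e → f (x k) + y k ≤ f X + e) (half+half ε) (proj₂ (near (half ε) (0<half 0<ε)))

  f-break : ∀ k → IsPiece extent k → f (x k) ≡ Σ< k y
  f-break zero    _  = trans (cong f x-zero) f-zero
  f-break (suc k) pk = trans (f-next k (next pk)) (cong (_+ y k) (f-break k (down pk)))

  Σy-mono : ∀ j k → j ℕ.≤ k → IsPiece extent k → Σ< j y ≤ Σ< k y
  Σy-mono j k j≤k pk with ℕ.m≤n⇒m<n∨m≡n j≤k
  ... | inj₂ refl = ≤-refl
  Σy-mono j (suc k) _ pk | inj₁ (ℕ.s≤s j≤k) = ≤-trans (Σy-mono j k j≤k (down pk))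
    (≤-by (0≤y (next pk)) (solve 2 (λ s y → (s :+ y) :- s := y :- κ 0) refl (Σ< k y) (y k)))

  line : ℕ → ℝ → ℝ
  line k t = Σ< k y + α k * (t - x k)

  f≡line : ∀ {k t} → IsPiece extent k → InPiece k t → f t ≡ line k t
  f≡line {k} {t} pk t∈k = trans (f-on-piece pk t∈k) (cong (_+ α k * (t - x k)) (f-break k pk))

  below? : ∀ n t → IsPiece extent n → 0# ≤ t → (∃ λ p → IsPiece extent p × InPiece p t) ⊎ x n ≤ t
  below? zero    t _  0≤t = inj₂ (subst (_≤ t) (sym x-zero) 0≤t)
  below? (suc n) t pn 0≤t with below? n t (down pn) 0≤t
  ... | inj₁ found = inj₁ found
  ... | inj₂ xn≤t with x (suc n) ≤? t
  ...   | yes p = inj₂ p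
  ...   | no ¬p = inj₁ (n , down pn , xn≤t , λ _ → ≰⇒> ¬p)

  locate : ∀ t → 0# ≤ t → ∃ λ p → IsPiece extent p × InPiece p t
  locate t 0≤t = go extent refl
    where
    go : ∀ e → extent ≡ e → ∃ λ p → IsPiece extent p × InPiece p t
    go (lastPiece ℓ) eq with below? ℓ t (subst (λ e → IsPiece e ℓ) (sym eq) ℕ.≤-refl) 0≤t
    ... | inj₁ found = found
    ... | inj₂ xℓ≤t  = ℓ , subst (λ e → IsPiece e ℓ) (sym eq) ℕ.≤-refl , xℓ≤t
                     , λ h → contradiction (subst (λ e → HasNext e ℓ) eq h) (ℕ.<-irrefl refl)
    -- `x-unbounded` yields only a weak inequality; asking for `t + 1#` places the break point
    -- strictly beyond `t`.
    go unending eq with x-unbounded eq (t + 1#)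
    ... | N , far with below? N t (subst (λ e → IsPiece e N) (sym eq) tt) 0≤t
    ...   | inj₁ found = found
    ...   | inj₂ xN≤t  = contradiction
              (≤-by (≤-trans (far N ℕ.≤-refl) xN≤t) (solve 2 (λ t u → κ 0 :- u := t :- (t :+ u)) refl t 1#))
              (<⇒≱ (0≤1 , 0≢1))

  -- Consecutive lines meet at the break point between their pieces, and to its right the later one
  -- has the smaller slope.
  line-antitone : ∀ j k {t} → j ℕ.≤ k → IsPiece extent k → x k ≤ t → line k t ≤ line j t
  line-antitone j k j≤k pk xk≤t with ℕ.m≤n⇒m<n∨m≡n j≤k
  ... | inj₂ refl = ≤-refl
  line-antitone j (suc k) {t} _ pk xk≤t | inj₁ (ℕ.s≤s j≤k) = ≤-trans
    (≤-by (*-monoʳ-≤ (≤⇒0≤ xk≤t) (α-antitone k pk))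
      (solve 6 (λ s a a′ x x′ t → (s :+ a :* (t :- x)) :- ((s :+ a :* (x′ :- x)) :+ a′ :* (t :- x′))
        := a :* (t :- x′) :- a′ :* (t :- x′)) refl (Σ< k y) (α k) (α (suc k)) (x k) (x (suc k)) t))
    (line-antitone j k j≤k (down pk) (≤-trans (<⇒≤ (x-increasing k (next pk))) xk≤t))

  -- The bounding line is parallel to piece `k` but starts from height `f (x k)` at 0. It lies above
  -- piece `k` and, as the slopes decrease, above all later pieces; on earlier pieces `f` does not
  -- exceed `f (x k)`. A request on level `k` is charged along this line.
  f≤tangent : ∀ k t → IsPiece extent k → 0# ≤ t → f t ≤ Σ< k y + α k * t
  f≤tangent k t pk 0≤t with locate t 0≤t
  ... | p , pp , t∈p = subst (_≤ Σ< k y + α k * t) (sym (f≡line pp t∈p)) (bound (k ℕ.≤? p))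
    where
    bound : Dec (k ℕ.≤ p) → line p t ≤ Σ< k y + α k * t
    bound (yes k≤p) = ≤-trans (line-antitone k p k≤p pp (proj₁ t∈p))
      (≤-by (*-nonNeg (0≤α pk) (0≤x k pk))
        (solve 4 (λ s a x t → (s :+ a :* t) :- (s :+ a :* (t :- x)) := a :* x :- κ 0) refl (Σ< k y) (α k) (x k) t))
    bound (no k≰p) = ≤-trans
      (+-monoʳ-≤ (Σ< p y) (*-monoˡ-≤ (0≤α pp)
        (≤-by (<⇒≤ (proj₂ t∈p hp)) (solve 3 (λ u v w → (u :- w) :- (v :- w) := u :- v) refl (x (suc p)) t (x p)))))
      (≤-trans (Σy-mono (suc p) k p<k pk)
        (≤-by (*-nonNeg (0≤α pk) 0≤t) (solve 2 (λ s v → (s :+ v) :- s := v :- κ 0) refl (Σ< k y) (α k * t))))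
      where
      p<k = ℕ.≰⇒> k≰p
      hp = next (IsPiece-mono extent p<k pk)

  Σy≤f : ∀ k t → IsPiece extent k → x k ≤ t → Σ< k y ≤ f t
  Σy≤f k t pk xk≤t with locate t (≤-trans (0≤x k pk) xk≤t)
  ... | p , pp , t∈p = subst (Σ< k y ≤_) (sym (f≡line pp t∈p)) (≤-trans (Σy-mono k p k≤p pp)
      (≤-by (*-nonNeg (0≤α pp) (≤⇒0≤ (proj₁ t∈p))) (solve 2 (λ s v → (s :+ v) :- s := v :- κ 0) refl (Σ< p y) _)))
    where
    k≤p : k ℕ.≤ p
    k≤p = ℕ.≮⇒≥ λ p<k → <⇒≱ (proj₂ t∈p (next (IsPiece-mono extent p<k pk)))
      (≤-trans (x-mono (suc p) k p<k pk) xk≤t)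

  0≤f : ∀ t → 0# ≤ t → 0# ≤ f t
  0≤f t 0≤t = Σy≤f 0 t (IsPiece-zero extent) (subst (_≤ t) (sym x-zero) 0≤t)

  -- The pieces before `x k` have total length `x k`, and all their slopes are at least `α k`.
  αx≤Σy : ∀ k → IsPiece extent k → α k * x k ≤ Σ< k y
  αx≤Σy zero    _  = ≤-reflexive (trans (cong (α 0 *_) x-zero) (zeroʳ _))
  αx≤Σy (suc k) pk = ≤-trans (*-monoʳ-≤ (0≤x (suc k) pk) (α-antitone k pk))
    (≤-by (αx≤Σy k (down pk)) (solve 4 (λ s a x x′ → (s :+ a :* (x′ :- x)) :- a :* x′ := s :- a :* x) refl (Σ< k y) (α k) (x k) (x (suc k))))

  Long : ℕ → ℝ → Set
  Long k g = HasNext extent k × x (suc k) ≤ g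

  long? : ∀ k g → Dec (Long k g)
  long? k g = hasNext? extent k ×-dec (x (suc k) ≤? g)

  share : ℕ → ℝ → ℝ
  share k g = if does (long? k g) then y k else α k * g

  -- Up to the piece of g the shares add up to the value of f at a break point;
  -- from there on they decrease geometrically.
  module _ {g : ℝ} (0≤g : 0# ≤ g) where
    private
      Before After : ℕ → Set
      Before K = IsPiece extent K × x K ≤ g × Σ< K (λ k → share k g) ≡ Σ< K y
      -- The additional `α K * g` is a reserve for the remaining levels: since the next slope is at
      -- most half as large, it covers the next share together with the next reserve.
      After K = (HasNext extent K → g < x (suc K)) ×
                Σ< (suc K) (λ k → share k g) + α K * g ≤ fromℕ 3 * f g

      stage : ∀ K → IsPiece extent K → Before (suc K) ⊎ After K
      stageFrom : ∀ K → IsPiece extent K → Before K → Before (suc K) ⊎ After K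

      stageFrom K pK (_ , xK≤g , eq) with long? K g in isLong
      ... | yes (hK , x≤g) = inj₁ (HasNext⇒IsPiece-suc extent hK , x≤g , cong₂ _+_ eq (cong (λ d → if does d then y K else α K * g) isLong))
      ... | no ¬long = inj₂ (g< , subst (λ v → v + α K * g ≤ fromℕ 3 * f g)
              (sym (cong₂ _+_ eq (cong (λ d → if does d then y K else α K * g) isLong)))
              (subst (λ v → Σ< K y + α K * g + α K * g ≤ fromℕ 3 * v) (sym (f≡line pK (xK≤g , g<)))
                -- On its piece `f g` is `Σ< K y + α K * (g - x K)`, so the claim amounts to 3
                -- `α K * x K` being at most 2 `Σ< K y + α K * g`. Two of the three terms are
                -- bounded by `αx≤Σy`, the third by `x K ≤ g`.
                (≤-by (+-mono-≤ (+-mono-≤ (αx≤Σy K pK) (αx≤Σy K pK)) (*-monoˡ-≤ (0≤α pK) xK≤g))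
                  (solve 4 (λ s a x g → κ 3 :* (s :+ a :* (g :- x)) :- ((s :+ a :* g) :+ a :* g)
                     := ((s :+ s) :+ a :* g) :- ((a :* x :+ a :* x) :+ a :* x)) refl (Σ< K y) (α K) (x K) g))))
        where
        g< : HasNext extent K → g < x (suc K)
        g< hK = ≰⇒> λ x≤g → ¬long (hK , x≤g)

      stage zero    p0 = stageFrom 0 p0 (p0 , subst (_≤ g) (sym x-zero) 0≤g , refl)
      stage (suc K) pK with stage K (down pK)
      ... | inj₁ before = stageFrom (suc K) pK before
      ... | inj₂ (g< , bound) with long? (suc K) g in isLong
      ...   | yes (hK , x≤g) = contradiction (≤-trans (<⇒≤ (x-increasing (suc K) hK)) x≤g) (<⇒≱ (g< (next pK)))
      ...   | no ¬long = inj₂ ((λ hK → ≰⇒> λ x≤g → ¬long (hK , x≤g))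
              , ≤-trans (≤-reflexive (cong (λ d → S + (if does d then y (suc K) else α (suc K) * g) + α (suc K) * g) isLong))
                (≤-trans (≤-by (*-monoʳ-≤ 0≤g (α-double K pK))
                  (solve 4 (λ s a a′ g → (s :+ a :* g) :- ((s :+ a′ :* g) :+ a′ :* g) := a :* g :- (a′ :+ a′) :* g)
                     refl S (α K) (α (suc K)) g)) bound))
        where S = Σ< (suc K) (λ k → share k g)

    Σshare≤3f : ∀ K → IsPiece extent K → Σ< (suc K) (λ k → share k g) ≤ fromℕ 3 * f g
    Σshare≤3f K pK with stage K pK
    ... | inj₁ (p , x≤g , eq) = subst (_≤ fromℕ 3 * f g) (sym eq) (≤-trans (Σy≤f (suc K) g p x≤g)
            (≤-by (+-nonNeg (0≤f g 0≤g) (0≤f g 0≤g)) (solve 1 (λ v → κ 3 :* v :- v := (v :+ v) :- κ 0) refl (f g))))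
    ... | inj₂ (_ , bound) = ≤-trans (≤-by (*-nonNeg (0≤α pK) 0≤g)
            (solve 2 (λ s v → (s :+ v) :- s := v :- κ 0) refl _ (α K * g))) bound

∣∣-mono-nonNeg : ∀ {i j} → 0ℤ ℤ.≤ i → i ℤ.≤ j → ∣ i ∣ ℕ.≤ ∣ j ∣
∣∣-mono-nonNeg (ℤ.+≤+ _) (ℤ.+≤+ m≤n) = m≤n

-- The reflection that sends `d` to `- suc d` preserves the direction of a unit step after the
-- polarities are exchanged; it derives the negative cases of the potential estimates from the
-- positive ones.
suc-neg-suc : ∀ d → ℤ.suc (ℤ.- ℤ.suc d) ≡ ℤ.- d
suc-neg-suc (ℤ.+ zero)      = refl
suc-neg-suc (ℤ.+ suc n)     = refl
suc-neg-suc -[1+ zero ]     = refl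
suc-neg-suc -[1+ suc n ]    = refl

⊖-one-sided : ∀ {m n} → m ≡ 0 ⊎ n ≡ 0 → ∣ m ⊖ n ∣ ≡ m ℕ.+ n
⊖-one-sided {n = n} (inj₁ refl) = ℤ.∣⊖∣-≤ {0} {n} ℕ.z≤n
⊖-one-sided {m = m} (inj₂ refl) = sym (ℕ.+-identityʳ m)

-- The potential of a single level.

module Potential (R : RealNumbers) where
  open RealNumbers R
  open Real R
  open Sums R

  -- Under a positive offset the weight −3 pays for the delay, which is at most
  -- three times the counter growth; the weight 8 covers the rise 4 y of Ψ, the
  -- cost y of a move and a loss of up to 3 y when a full counter is reset.
  weight : ℤ → ℝ
  weight (ℤ.+ suc _) = - fromℕ 3
  weight (ℤ.+ zero)  = fromℕ 8
  weight -[1+ _ ]    = fromℕ 8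

  -- Here `y` is the capacity, `d` the offset, and `u` and `v` are the positive and the negative
  -- counter. At most one counter has weight -3, and only for nonzero `d`; then 4 `y` times the
  -- absolute offset outweighs it and leaves at least `y`.
  Ψ : ℝ → ℤ → ℝ → ℝ → ℝ
  Ψ y d u v = fromℕ 4 * (y * fromℕ ∣ d ∣) + (weight d * u + weight (ℤ.- d) * v)

  Ψ-neg : ∀ y d u v → Ψ y (ℤ.- d) v u ≡ Ψ y d u v
  Ψ-neg y d u v = cong₂ _+_ (cong (λ n → fromℕ 4 * (y * fromℕ n)) (ℤ.∣-i∣≡∣i∣ d))
    (trans (cong (λ e → weight (ℤ.- d) * v + weight e * u) (ℤ.neg-involutive d)) (+-comm _ _))

  0≤n* : ∀ n {v} → 0# ≤ v → 0# ≤ fromℕ n * v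
  0≤n* n = *-nonNeg (0≤fromℕ n)

  Ψ-zero-nonNeg : ∀ y {u v} → 0# ≤ u → 0# ≤ v → 0# ≤ Ψ y 0ℤ u v
  Ψ-zero-nonNeg y {u} {v} 0≤u 0≤v = ≤-by (+-nonNeg (0≤n* 8 0≤u) (0≤n* 8 0≤v))
    (solve 3 (λ y u v → (κ 4 :* (y :* κ 0) :+ (κ 8 :* u :+ κ 8 :* v)) :- κ 0 := (κ 8 :* u :+ κ 8 :* v) :- κ 0) refl y u v)

  private
    positive-nonNeg : ∀ {y} n {u v} → 0# ≤ y → u ≤ y → 0# ≤ v → 0# ≤ Ψ y (ℤ.+ suc n) u v
    positive-nonNeg {y} n {u} {v} 0≤y u≤y 0≤v rewrite fromℕ-+ 1 n =
      ≤-by (+-mono-≤ (+-mono-≤ (*-monoˡ-≤ (0≤fromℕ 3) u≤y) 0≤y) (+-nonNeg (0≤n* 4 (*-nonNeg 0≤y (0≤fromℕ n))) (0≤n* 8 0≤v)))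
        (solve 4 (λ y n u v → (κ 4 :* (y :* (κ 1 :+ n)) :+ (:- κ 3 :* u :+ κ 8 :* v)) :- κ 0
          := ((κ 3 :* y :+ y) :+ (κ 4 :* (y :* n) :+ κ 8 :* v)) :- ((κ 3 :* u :+ κ 0) :+ κ 0)) refl y (fromℕ n) u v)

  Ψ-nonNeg : ∀ {y} d {u v} → 0# ≤ y → 0# ≤ u → u ≤ y → 0# ≤ v → v ≤ y → 0# ≤ Ψ y d u v
  Ψ-nonNeg     (ℤ.+ zero)  _   0≤u u≤y 0≤v v≤y = Ψ-zero-nonNeg _ 0≤u 0≤v
  Ψ-nonNeg     (ℤ.+ suc n) 0≤y 0≤u u≤y 0≤v v≤y = positive-nonNeg n 0≤y u≤y 0≤v
  Ψ-nonNeg {y} -[1+ n ]    0≤y 0≤u u≤y 0≤v v≤y =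
    subst (0# ≤_) (Ψ-neg y -[1+ n ] _ _) (positive-nonNeg n 0≤y v≤y 0≤u)

  -- A positive request leaves the level, so the offset falls from `suc d` to `d`. If `suc d` is
  -- positive, the 4 `y` released by the offset make up for the loss of -3 `y` and leave `y`.
  -- Otherwise the full counter releases 8 `y`, against a rise of 4 `y` from the offset and at most
  -- 3 `y` from resetting the opposite counter.
  Ψ-reset⁺ : ∀ {y} d {v} → 0# ≤ y → 0# ≤ v → v ≤ y → Ψ y d 0# 0# + y ≤ Ψ y (ℤ.suc d) y v
  Ψ-reset⁺ {y} (ℤ.+ n) {v} 0≤y 0≤v v≤y rewrite fromℕ-+ 1 n =
    ≤-by (0≤n* 8 0≤v) (solve 5 (λ y n v a b → (κ 4 :* (y :* (κ 1 :+ n)) :+ (:- κ 3 :* y :+ κ 8 :* v))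
      :- ((κ 4 :* (y :* n) :+ (a :* κ 0 :+ b :* κ 0)) :+ y) := κ 8 :* v :- κ 0) refl y (fromℕ n) v (weight (ℤ.+ n)) (weight (ℤ.- (ℤ.+ n))))
  Ψ-reset⁺ {y} -[1+ zero ] {v} 0≤y 0≤v v≤y =
    ≤-by (+-nonNeg (0≤n* 3 0≤y) (0≤n* 8 0≤v)) (solve 2 (λ y v → (κ 4 :* (y :* κ 0) :+ (κ 8 :* y :+ κ 8 :* v))
      :- ((κ 4 :* (y :* κ 1) :+ (κ 8 :* κ 0 :+ :- κ 3 :* κ 0)) :+ y) := (κ 3 :* y :+ κ 8 :* v) :- κ 0) refl y v)
  Ψ-reset⁺ {y} -[1+ suc n ] {v} 0≤y 0≤v v≤y rewrite fromℕ-+ 2 n | fromℕ-+ 1 n =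
    ≤-by (*-monoˡ-≤ (0≤fromℕ 3) v≤y) (solve 3 (λ y n v → (κ 4 :* (y :* (κ 1 :+ n)) :+ (κ 8 :* y :+ :- κ 3 :* v))
      :- ((κ 4 :* (y :* (κ 2 :+ n)) :+ (κ 8 :* κ 0 :+ :- κ 3 :* κ 0)) :+ y) := κ 3 :* y :- κ 3 :* v) refl y (fromℕ n) v)

  -- The mirror image: a negative request that leaves the level raises the offset.
  Ψ-reset⁻ : ∀ {y} d {u} → 0# ≤ y → 0# ≤ u → u ≤ y → Ψ y (ℤ.suc d) 0# 0# + y ≤ Ψ y d u y
  Ψ-reset⁻ {y} d {u} 0≤y 0≤u u≤y =
    subst₂ (λ a b → a + y ≤ b) (Ψ-neg y (ℤ.suc d) 0# 0#)
      (trans (cong (λ e → Ψ y e y u) (suc-neg-suc d)) (Ψ-neg y d u y))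
      (Ψ-reset⁺ (ℤ.- ℤ.suc d) 0≤y 0≤u u≤y)

  -- The critical step goes from -1 to 0. It releases 4 `y`, but the weight of `v` jumps from -3 to
  -- 8 and may add 11 `y`; the difference is the constant 7.
  Ψ-suc : ∀ {y} d {u v} → 0# ≤ y → 0# ≤ u → v ≤ y → Ψ y (ℤ.suc d) u v ≤ Ψ y d u v + fromℕ 7 * y
  Ψ-suc {y} (ℤ.+ zero) {u} {v} 0≤y 0≤u v≤y =
    ≤-by (+-nonNeg (0≤n* 3 0≤y) (0≤n* 11 0≤u)) (solve 3 (λ y u v →
      ((κ 4 :* (y :* κ 0) :+ (κ 8 :* u :+ κ 8 :* v)) :+ κ 7 :* y) :- (κ 4 :* (y :* κ 1) :+ (:- κ 3 :* u :+ κ 8 :* v))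
        := (κ 3 :* y :+ κ 11 :* u) :- κ 0) refl y u v)
  Ψ-suc {y} (ℤ.+ suc n) {u} {v} 0≤y 0≤u v≤y rewrite fromℕ-+ 2 n | fromℕ-+ 1 n =
    ≤-by (0≤n* 3 0≤y) (solve 4 (λ y n u v →
      ((κ 4 :* (y :* (κ 1 :+ n)) :+ (:- κ 3 :* u :+ κ 8 :* v)) :+ κ 7 :* y) :- (κ 4 :* (y :* (κ 2 :+ n)) :+ (:- κ 3 :* u :+ κ 8 :* v))
        := κ 3 :* y :- κ 0) refl y (fromℕ n) u v)
  Ψ-suc {y} -[1+ zero ] {u} {v} 0≤y 0≤u v≤y =
    ≤-by (*-monoˡ-≤ (0≤fromℕ 11) v≤y) (solve 3 (λ y u v →
      ((κ 4 :* (y :* κ 1) :+ (κ 8 :* u :+ :- κ 3 :* v)) :+ κ 7 :* y) :- (κ 4 :* (y :* κ 0) :+ (κ 8 :* u :+ κ 8 :* v))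
        := κ 11 :* y :- κ 11 :* v) refl y u v)
  Ψ-suc {y} -[1+ suc n ] {u} {v} 0≤y 0≤u v≤y rewrite fromℕ-+ 2 n | fromℕ-+ 1 n =
    ≤-by (0≤n* 11 0≤y) (solve 4 (λ y n u v →
      ((κ 4 :* (y :* (κ 2 :+ n)) :+ (κ 8 :* u :+ :- κ 3 :* v)) :+ κ 7 :* y) :- (κ 4 :* (y :* (κ 1 :+ n)) :+ (κ 8 :* u :+ :- κ 3 :* v))
        := κ 11 :* y :- κ 0) refl y (fromℕ n) u v)

  Ψ-pred : ∀ {y} d {u v} → 0# ≤ y → 0# ≤ v → u ≤ y → Ψ y d u v ≤ Ψ y (ℤ.suc d) u v + fromℕ 7 * y
  Ψ-pred {y} d {u} {v} 0≤y 0≤v u≤y =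
    subst₂ (λ a b → a ≤ b + fromℕ 7 * y)
      (trans (cong (λ e → Ψ y e v u) (suc-neg-suc d)) (Ψ-neg y d u v)) (Ψ-neg y (ℤ.suc d) u v)
      (Ψ-suc (ℤ.- ℤ.suc d) 0≤y 0≤v u≤y)

  -- While the offset d is positive the growth of the counter is paid for by the
  -- potential; otherwise the reference surplus t is at least s.
  Ψ-grow⁺ : ∀ y d s t {c u v} → 0# ≤ c → 0ℤ ℤ.< s → s ≡ d ℤ.+ t →
            Ψ y d (u + c * fromℕ ∣ s ∣) v + fromℕ 3 * (c * fromℕ ∣ s ∣)
              ≤ Ψ y d u v + fromℕ 14 * (c * fromℕ ∣ t ∣)
  Ψ-grow⁺ y (ℤ.+ suc n) s t {c} {u} {v} 0≤c 0<s s≡ =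
    ≤-by (0≤n* 14 (*-nonNeg 0≤c (0≤fromℕ ∣ t ∣))) (solve 5 (λ p u v e e′ →
      ((p :+ (:- κ 3 :* u :+ κ 8 :* v)) :+ κ 14 :* e′) :- ((p :+ (:- κ 3 :* (u :+ e) :+ κ 8 :* v)) :+ κ 3 :* e)
        := κ 14 :* e′ :- κ 0) refl (fromℕ 4 * (y * fromℕ (suc n))) u v (c * fromℕ ∣ s ∣) (c * fromℕ ∣ t ∣))
  Ψ-grow⁺ y d@(ℤ.+ zero) s t {c} {u} {v} 0≤c 0<s s≡ =
    -- Growth at weight 8 and the 3 claimed on the left make 11; the slack up to 14 matches the
    -- price 2 · 7 of dropping a pair.
    ≤-by (+-mono-≤ (*-monoˡ-≤ (0≤fromℕ 11) e≤e′) (0≤n* 3 (*-nonNeg 0≤c (0≤fromℕ ∣ t ∣)))) (solve 5 (λ p u v e e′ →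
      ((p :+ (κ 8 :* u :+ κ 8 :* v)) :+ κ 14 :* e′) :- ((p :+ (κ 8 :* (u :+ e) :+ κ 8 :* v)) :+ κ 3 :* e)
        := (κ 11 :* e′ :+ κ 3 :* e′) :- (κ 11 :* e :+ κ 0)) refl (fromℕ 4 * (y * fromℕ 0)) u v (c * fromℕ ∣ s ∣) (c * fromℕ ∣ t ∣))
    where
    e≤e′ : c * fromℕ ∣ s ∣ ≤ c * fromℕ ∣ t ∣
    e≤e′ = ≤-reflexive (cong (λ i → c * fromℕ ∣ i ∣) (trans s≡ (ℤ.+-identityˡ t)))
  Ψ-grow⁺ y d@(-[1+ n ]) s t {c} {u} {v} 0≤c 0<s s≡ =
    ≤-by (+-mono-≤ (*-monoˡ-≤ (0≤fromℕ 11) e≤e′) (0≤n* 3 (*-nonNeg 0≤c (0≤fromℕ ∣ t ∣)))) (solve 5 (λ p u v e e′ →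
      ((p :+ (κ 8 :* u :+ :- κ 3 :* v)) :+ κ 14 :* e′) :- ((p :+ (κ 8 :* (u :+ e) :+ :- κ 3 :* v)) :+ κ 3 :* e)
        := (κ 11 :* e′ :+ κ 3 :* e′) :- (κ 11 :* e :+ κ 0)) refl (fromℕ 4 * (y * fromℕ (suc n))) u v (c * fromℕ ∣ s ∣) (c * fromℕ ∣ t ∣))
    where
    s≤t : s ℤ.≤ t
    s≤t = subst (s ℤ.≤_) (ℤ.+-identityˡ t) (subst (ℤ._≤ 0ℤ ℤ.+ t) (sym s≡) (ℤ.+-monoˡ-≤ t ℤ.-≤+))
    e≤e′ : c * fromℕ ∣ s ∣ ≤ c * fromℕ ∣ t ∣
    e≤e′ = *-monoˡ-≤ 0≤c (fromℕ-mono-≤ (∣∣-mono-nonNeg (ℤ.<⇒≤ 0<s) s≤t))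

  Ψ-grow⁻ : ∀ y d s t {c u v} → 0# ≤ c → s ℤ.< 0ℤ → s ≡ d ℤ.+ t →
            Ψ y d u (v + c * fromℕ ∣ s ∣) + fromℕ 3 * (c * fromℕ ∣ s ∣)
              ≤ Ψ y d u v + fromℕ 14 * (c * fromℕ ∣ t ∣)
  Ψ-grow⁻ y d s t {c} {u} {v} 0≤c s<0 s≡
    with grown ← Ψ-grow⁺ y (ℤ.- d) (ℤ.- s) (ℤ.- t) {c} {v} {u} 0≤c (ℤ.neg-mono-< s<0)
                   (trans (cong ℤ.-_ s≡) (ℤ.neg-distrib-+ d t))
    rewrite ℤ.∣-i∣≡∣i∣ s | ℤ.∣-i∣≡∣i∣ t
    = subst₂ (λ a b → a + fromℕ 3 * (c * fromℕ ∣ s ∣) ≤ b + fromℕ 14 * (c * fromℕ ∣ t ∣))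
        (Ψ-neg y d u _) (Ψ-neg y d u v) grown

  -- The surpluses s are bounded by the growing ones among them, as the rates β
  -- halve from one level to the next.
  waiting≤growth : (β b : ℕ → ℝ) (s : ℕ → ℤ) (n : ℕ → ℕ) → ∀ K →
    (∀ k → k ℕ.≤ K → 0# ≤ β k) →
    (∀ k → k ℕ.< K → β (suc k) + β (suc k) ≤ β k) →
    n 0 ℕ.≤ ∣ s 0 ∣ → (∀ k → n (suc k) ℕ.≤ ∣ s (suc k) ∣ ℕ.+ ∣ s k ∣) →
    β 0 * fromℕ ∣ s 0 ∣ ≤ b 0 →
    (∀ k → k ℕ.< K → β (suc k) * fromℕ ∣ s (suc k) ∣ ≤ b (suc k) + β (suc k) * fromℕ ∣ s k ∣) →
    Σ< (suc K) (λ k → β k * fromℕ (n k)) ≤ fromℕ 3 * Σ< (suc K) b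
  waiting≤growth β b s n K 0≤β halving n₀ nₛ b₀ bₛ =
    ≤-trans (≤-by (0≤n* 2 (*-nonNeg (0≤β K ℕ.≤-refl) (0≤fromℕ ∣ s K ∣)))
      (solve 2 (λ v w → (v :+ w) :- v := w :- κ 0) refl _ _)) (go K ℕ.≤-refl)
    where
    -- The induction carries the reserve 2 `β k` times the absolute surplus. A new level, with its
    -- own reserve, costs at most 3 `b (suc k)` plus 4 `β (suc k)` times the previous absolute
    -- surplus, and 4 `β (suc k)` is at most 2 `β k`.
    go : ∀ k → k ℕ.≤ K →
         Σ< (suc k) (λ k → β k * fromℕ (n k)) + fromℕ 2 * (β k * fromℕ ∣ s k ∣) ≤ fromℕ 3 * Σ< (suc k) b
    go zero _ = ≤-by (+-mono-≤ (*-monoˡ-≤ (0≤β 0 ℕ.z≤n) (fromℕ-mono-≤ n₀)) (*-monoˡ-≤ (0≤fromℕ 3) b₀))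
      (solve 3 (λ v w b → κ 3 :* (κ 0 :+ b) :- ((κ 0 :+ v) :+ κ 2 :* w) := (w :+ κ 3 :* b) :- (v :+ κ 3 :* w))
        refl (β 0 * fromℕ (n 0)) (β 0 * fromℕ ∣ s 0 ∣) (b 0))
    go (suc k) k<K = ≤-by
      (+-mono-≤ (+-mono-≤ (go k (ℕ.<⇒≤ k<K)) (*-monoˡ-≤ (0≤fromℕ 2) (*-monoʳ-≤ (0≤fromℕ ∣ s k ∣) (halving k k<K))))
        (+-mono-≤ (*-monoˡ-≤ (0≤fromℕ 3) (bₛ k k<K))
          (*-monoˡ-≤ (0≤β (suc k) k<K) (subst (fromℕ (n (suc k)) ≤_) (fromℕ-+ ∣ s (suc k) ∣ ∣ s k ∣) (fromℕ-mono-≤ (nₛ k))))))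
      (solve 8 (λ S B m b′ β β′ σ σ′ →
        κ 3 :* (B :+ b′) :- ((S :+ β′ :* m) :+ κ 2 :* (β′ :* σ′)) :=
        ((κ 3 :* B :+ κ 2 :* (β :* σ)) :+ (κ 3 :* (b′ :+ β′ :* σ) :+ β′ :* (σ′ :+ σ)))
          :- (((S :+ κ 2 :* (β :* σ)) :+ κ 2 :* ((β′ :+ β′) :* σ)) :+ (κ 3 :* (β′ :* σ′) :+ β′ :* m)))
        refl (Σ< (suc k) (λ k → β k * fromℕ (n k))) (Σ< (suc k) b) (fromℕ (n (suc k))) (b (suc k)) (β k) (β (suc k))
          (fromℕ ∣ s k ∣) (fromℕ ∣ s (suc k) ∣))

-- Offsets, the reference cost and the invariant.

module Offsets (R : RealNumbers) (F : Concave.ExpPiecewiseLinear R) (I : Concave.Instance R)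
               (π : Permutation′ (Concave.Instance.m I)) where
  open RealNumbers R
  open Real R
  open Sums R
  open Potential R
  open PiecewiseLinear R F
  open Concave R
  open ExpPiecewiseLinear F
  open Instance I
  open BPSLA F I
  open State
  open CommutativeMonoidSum ℤ.+-0-commutativeMonoid public using ()
    renaming (sum to sumℤ; ∑-distrib-+ to sumℤ-distrib-+; sum-cong-≗ to sumℤ-cong; sum-permute to sumℤ-permute)

  total : (Request → ℝ) → ℝ
  total h = sum (λ i → h (pos , i)) + sum (λ i → h (neg , i))

  total-cong : ∀ {h g : Request → ℝ} → (∀ r → h r ≡ g r) → total h ≡ total g
  total-cong h≡g = cong₂ _+_ (sum-cong (λ i → h≡g (pos , i))) (sum-cong (λ i → h≡g (neg , i)))

  balance : (Request → ℤ) → ℤ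
  balance h = sumℤ (λ i → h (pos , i)) ℤ.- sumℤ (λ i → h (neg , i))

  balance-cong : ∀ {h g : Request → ℤ} → (∀ r → h r ≡ g r) → balance h ≡ balance g
  balance-cong h≡g = cong₂ ℤ._-_ (sumℤ-cong (λ i → h≡g (pos , i))) (sumℤ-cong (λ i → h≡g (neg , i)))

  balance-distrib-+ : ∀ h g → balance (λ r → h r ℤ.+ g r) ≡ balance h ℤ.+ balance g
  balance-distrib-+ h g = trans (cong₂ ℤ._-_ (sumℤ-distrib-+ (λ i → h (pos , i)) (λ i → g (pos , i)))
                                            (sumℤ-distrib-+ (λ i → h (neg , i)) (λ i → g (neg , i))))
    (S.solve 4 (λ a b c d → (a S.:+ b) S.:- (c S.:+ d) S.:= (a S.:- c) S.:+ (b S.:- d)) refl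
      (sumℤ (λ i → h (pos , i))) (sumℤ (λ i → g (pos , i))) (sumℤ (λ i → h (neg , i))) (sumℤ (λ i → g (neg , i))))
    where module S = +-*-Solver

  update-same : ∀ σ r v → (σ [ r ≔ v ]) r ≡ v
  update-same σ r v rewrite dec-true (r ≟ᵣ r) refl = refl

  update-other : ∀ σ r v {q} → q ≢ r → (σ [ r ≔ v ]) q ≡ σ q
  update-other σ r v {q} q≢r rewrite dec-false (q ≟ᵣ r) q≢r = refl

  module _ {A : Set} (h : Request → Status → A) where
    update-invariant : ∀ σ r v → h r v ≡ h r (σ r) → ∀ q → h q ((σ [ r ≔ v ]) q) ≡ h q (σ q)
    update-invariant σ r v same q with q ≟ᵣ r
    ... | yes refl = same
    ... | no  _    = refl

  total-update : ∀ (h : Request → Status → ℝ) σ r v →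
    total (λ q → h q ((σ [ r ≔ v ]) q)) + h r (σ r) ≡ total (λ q → h q (σ q)) + h r v
  total-update h σ (pos , i) v = begin
    P′ + N′ + h r (σ r)     ≡⟨ solve 3 (λ p n u → p :+ n :+ u := (p :+ u) :+ n) refl P′ N′ _ ⟩
    (P′ + h r (σ r)) + N′   ≡⟨ cong₂ _+_ (sum-update +-commutativeMonoid _ _ i
                                 (λ j j≢i → cong (h (pos , j)) (update-other σ r v (j≢i ∘ cong proj₂)))) (sum-cong (λ j →
                                 cong (h (neg , j)) (update-other σ r v λ ()))) ⟩
    (P + h r ((σ [ r ≔ v ]) r)) + N  ≡⟨ cong (λ w → (P + h r w) + N) (update-same σ r v) ⟩
    (P + h r v) + N         ≡⟨ solve 3 (λ p n u → (p :+ u) :+ n := p :+ n :+ u) refl P N _ ⟩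
    P + N + h r v           ∎
    where
    open ≡-Reasoning
    r = pos , i
    P  = sum (λ j → h (pos , j) (σ (pos , j)))
    N  = sum (λ j → h (neg , j) (σ (neg , j)))
    P′ = sum (λ j → h (pos , j) ((σ [ r ≔ v ]) (pos , j)))
    N′ = sum (λ j → h (neg , j) ((σ [ r ≔ v ]) (neg , j)))
  total-update h σ (neg , i) v = begin
    P′ + N′ + h r (σ r)     ≡⟨ solve 3 (λ p n u → p :+ n :+ u := p :+ (n :+ u)) refl P′ N′ _ ⟩
    P′ + (N′ + h r (σ r))   ≡⟨ cong₂ _+_ (sum-cong (λ j → cong (h (pos , j)) (update-other σ r v λ ())))
                                 (sum-update +-commutativeMonoid _ _ i
                                 (λ j j≢i → cong (h (neg , j)) (update-other σ r v (j≢i ∘ cong proj₂)))) ⟩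
    P + (N + h r ((σ [ r ≔ v ]) r))  ≡⟨ cong (λ w → P + (N + h r w)) (update-same σ r v) ⟩
    P + (N + h r v)         ≡⟨ solve 3 (λ p n u → p :+ (n :+ u) := p :+ n :+ u) refl P N _ ⟩
    P + N + h r v           ∎
    where
    open ≡-Reasoning
    r = neg , i
    P  = sum (λ j → h (pos , j) (σ (pos , j)))
    N  = sum (λ j → h (neg , j) (σ (neg , j)))
    P′ = sum (λ j → h (pos , j) ((σ [ r ≔ v ]) (pos , j)))
    N′ = sum (λ j → h (neg , j) ((σ [ r ≔ v ]) (neg , j)))

  balance-update⁺ : ∀ (h : Request → Status → ℤ) σ i v →
    balance (λ q → h q ((σ [ pos , i ≔ v ]) q)) ℤ.+ h (pos , i) (σ (pos , i))
      ≡ balance (λ q → h q (σ q)) ℤ.+ h (pos , i) v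
  balance-update⁺ h σ i v = begin
    (P′ ℤ.- N′) ℤ.+ h r (σ r)   ≡⟨ S.solve 3 (λ p n u → (p S.:- n) S.:+ u S.:= (p S.:+ u) S.:- n) refl P′ N′ (h r (σ r)) ⟩
    (P′ ℤ.+ h r (σ r)) ℤ.- N′   ≡⟨ cong₂ ℤ._-_ (sum-update ℤ.+-0-commutativeMonoid _ _ i
                                     (λ j j≢i → cong (h (pos , j)) (update-other σ r v (j≢i ∘ cong proj₂)))) (sumℤ-cong (λ j →
                                     cong (h (neg , j)) (update-other σ r v λ ()))) ⟩
    (P ℤ.+ h r ((σ [ r ≔ v ]) r)) ℤ.- N  ≡⟨ cong (λ w → (P ℤ.+ h r w) ℤ.- N) (update-same σ r v) ⟩
    (P ℤ.+ h r v) ℤ.- N         ≡⟨ S.solve 3 (λ p n u → (p S.:+ u) S.:- n S.:= (p S.:- n) S.:+ u) refl P N (h r v) ⟩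
    (P ℤ.- N) ℤ.+ h r v         ∎
    where
    open ≡-Reasoning
    module S = +-*-Solver
    r = pos , i
    P  = sumℤ (λ j → h (pos , j) (σ (pos , j)))
    N  = sumℤ (λ j → h (neg , j) (σ (neg , j)))
    P′ = sumℤ (λ j → h (pos , j) ((σ [ r ≔ v ]) (pos , j)))
    N′ = sumℤ (λ j → h (neg , j) ((σ [ r ≔ v ]) (neg , j)))

  -- Negative requests are subtracted in `balance`, so the old and the new contribution trade sides
  -- compared with the positive case.
  balance-update⁻ : ∀ (h : Request → Status → ℤ) σ i v →
    balance (λ q → h q ((σ [ neg , i ≔ v ]) q)) ℤ.+ h (neg , i) v
      ≡ balance (λ q → h q (σ q)) ℤ.+ h (neg , i) (σ (neg , i))
  balance-update⁻ h σ i v = begin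
    (P′ ℤ.- N′) ℤ.+ h r v        ≡⟨ cong₂ (λ p w → (p ℤ.- N′) ℤ.+ h r w) (sumℤ-cong (λ j → cong (h (pos , j))
                                      (update-other σ r v λ ()))) (sym (update-same σ r v)) ⟩
    (P ℤ.- N′) ℤ.+ v′            ≡⟨ S.solve 4 (λ p n u w → (p S.:- n) S.:+ u S.:= ((p S.:+ u) S.:+ w) S.:- (n S.:+ w)) refl P N′ v′ (h r (σ r)) ⟩
    (P ℤ.+ v′ ℤ.+ h r (σ r)) ℤ.- (N′ ℤ.+ h r (σ r))
      ≡⟨ cong (λ n → (P ℤ.+ v′ ℤ.+ h r (σ r)) ℤ.- n) (sum-update ℤ.+-0-commutativeMonoid _ _ i
           (λ j j≢i → cong (h (neg , j)) (update-other σ r v (j≢i ∘ cong proj₂)))) ⟩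
    (P ℤ.+ v′ ℤ.+ h r (σ r)) ℤ.- (N ℤ.+ v′)
      ≡⟨ S.solve 4 (λ p n u w → ((p S.:+ u) S.:+ w) S.:- (n S.:+ u) S.:= (p S.:- n) S.:+ w) refl P N v′ (h r (σ r)) ⟩
    (P ℤ.- N) ℤ.+ h r (σ r)      ∎
    where
    open ≡-Reasoning
    module S = +-*-Solver
    r = neg , i
    P  = sumℤ (λ j → h (pos , j) (σ (pos , j)))
    N  = sumℤ (λ j → h (neg , j) (σ (neg , j)))
    P′ = sumℤ (λ j → h (pos , j) ((σ [ r ≔ v ]) (pos , j)))
    N′ = sumℤ (λ j → h (neg , j) ((σ [ r ≔ v ]) (neg , j)))
    v′ = h r ((σ [ r ≔ v ]) r)

  pairOf : Request → Fin m
  pairOf (pos , i) = i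
  pairOf (neg , j) = π ⟨$⟩ˡ j

  ∣_∣ᵣ : ℝ → ℝ
  ∣ v ∣ᵣ = v ⊔ - v

  gap : Fin m → ℝ
  gap i = ∣ arrival (pos , i) - arrival (neg , π ⟨$⟩ʳ i) ∣ᵣ

  isLong : ℕ → Fin m → Bool
  isLong k i = does (long? k (gap i))

  -- The reference solution uses π; at level k it drops long pairs on arrival.
  kept : ℕ → Request → ℤ
  kept k r = if isLong k (pairOf r) then 0ℤ else 1ℤ

  upTo : ℕ → ℕ → ℤ
  upTo k j = if does (j ℕ.≤? k) then 1ℤ else 0ℤ

  onUpTo : ℕ → Status → ℤ
  onUpTo k (on j) = upTo k j
  onUpTo k _      = 0ℤ

  -- Matched requests go on counting: once both requests of a kept pair have arrived, they cancel in
  -- `balance`. The surplus of a reference that matches each pair at its later arrival is thus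
  -- obtained without recording its matches.
  keptArrived : ℕ → Request → Status → ℤ
  keptArrived k r unarrived = 0ℤ
  keptArrived k r _         = kept k r

  surplusOffset : ℕ → Request → Status → ℤ
  surplusOffset k r v = onUpTo k v ℤ.- keptArrived k r v

  offset reference : ℕ → (Request → Status) → ℤ
  offset k σ    = balance (λ r → surplusOffset k r (σ r))
  reference k σ = balance (λ r → keptArrived k r (σ r))

  dropCost : ℕ → Request → Status → ℝ
  dropCost k r unarrived = 0#
  dropCost k r _         = if isLong k (pairOf r) then y k else 0#

  -- The time, up to `t`, during which exactly one of the requests arriving at `a` and `b` is
  -- present.
  spread : ℝ → ℝ → ℝ → ℝ
  spread t a b = ∣ t ⊓ a - t ⊓ b ∣ᵣ

  keepCost : ℕ → ℝ → Fin m → ℝ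
  keepCost k t i = if isLong k i then 0# else α k * spread t (arrival (pos , i)) (arrival (neg , π ⟨$⟩ʳ i))

  -- The factor 7 is the rise of `Ψ` caused by one drop, which each request of a long pair pays
  -- separately. With 14 on kept pairs, every pair ends up paying 14 times its `share`.
  referenceCost : ℕ → ℝ → (Request → Status) → ℝ
  referenceCost k t σ = fromℕ 14 * sum (keepCost k t) + fromℕ 7 * total (λ r → dropCost k r (σ r))

  excess : ℕ → State → ℝ
  excess k s = Ψ (y k) (offset k (status s)) (counter s pos k) (counter s neg k) - referenceCost k (now s) (status s)

  -- A waiting request is charged the line of `f≤tangent` instead of `f` itself: the line rises with
  -- slope `α k` while time passes and by at most `y k` at a move, which are the amounts that the
  -- counters can pay for.
  accrued : ℝ → Request → Status → ℝ
  accrued t r unarrived     = 0#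
  accrued t r (on k)        = Σ< k y + α k * (t - arrival r)
  accrued t r (matched _ u) = f (u - arrival r)

  totalAccrued : State → ℝ
  totalAccrued s = total (λ r → accrued (now s) r (status s r))

  potential : ℕ → State → ℝ
  potential K s = totalAccrued s + Σ< K (λ k → excess k s)

  -- The bound `K` keeps the sum over levels finite. A last piece has no capacity, so nothing bounds
  -- its counters from above and a weight of -3 could make `Ψ` negative; `last` excludes this, since
  -- no request leaves that level and no pair is long there.
  record Invariant (K : ℕ) (s : State) : Set where
    field
      pending   : ∀ r → status s r ≡ unarrived → now s ≤ arrival r
      started   : ∀ r → status s r ≢ unarrived → arrival r ≤ now s
      levels    : ∀ r k → status s r ≡ on k → k ℕ.< K
      nonNeg    : ∀ p k → k ℕ.< K → 0# ≤ counter s p k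
      capped    : ∀ p k → HasNext extent k → counter s p k ≤ y k
      last      : ∀ k → ¬ HasNext extent k → offset k (status s) ≡ 0ℤ
      bounded   : potential K s ≤ 0#

  upTo-suc : ∀ {k j} → k ≢ j → upTo k (suc j) ≡ upTo k j
  upTo-suc {k} {j} k≢j = cong (λ b → if b then 1ℤ else 0ℤ) (does-⇔ (mk⇔ ℕ.<⇒≤ (λ j≤k → ℕ.≤∧≢⇒< j≤k (k≢j ∘ sym)))
    (suc j ℕ.≤? k) (j ℕ.≤? k))

  upTo-self : ∀ k → upTo k k ≡ 1ℤ
  upTo-self k rewrite dec-true (k ℕ.≤? k) ℕ.≤-refl = refl

  upTo-self-suc : ∀ k → upTo k (suc k) ≡ 0ℤ
  upTo-self-suc k rewrite dec-false (suc k ℕ.≤? k) (ℕ.<-irrefl refl) = refl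

  offset-unchanged : ∀ k σ r v → surplusOffset k r v ≡ surplusOffset k r (σ r) →
    offset k (σ [ r ≔ v ]) ≡ offset k σ
  offset-unchanged k σ r v same = balance-cong (update-invariant (surplusOffset k) σ r v same)

  module _ (k : ℕ) (σ : Request → Status) where
    private
      step : ∀ d d′ {u v} → d′ ℤ.+ u ≡ d ℤ.+ v → v ≡ ℤ.suc u → d′ ≡ ℤ.suc d
      step d d′ {u} eq refl = begin
        d′                        ≡⟨ S.solve 2 (λ d u → d S.:= (d S.:+ u) S.:- u) refl d′ u ⟩
        (d′ ℤ.+ u) ℤ.- u          ≡⟨ cong (ℤ._- u) eq ⟩
        (d ℤ.+ ℤ.suc u) ℤ.- u     ≡⟨ S.solve 2 (λ d u → (d S.:+ (S.con 1ℤ S.:+ u)) S.:- u S.:= S.con 1ℤ S.:+ d) refl d u ⟩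
        ℤ.suc d                   ∎
        where
        open ≡-Reasoning
        module S = +-*-Solver

    -- Each change of the offset is expressed by `ℤ.suc` of the smaller value, the form in which the
    -- estimates for `Ψ` take it.
    offset-increases⁺ : ∀ i v → surplusOffset k (pos , i) v ≡ ℤ.suc (surplusOffset k (pos , i) (σ (pos , i))) →
      offset k (σ [ pos , i ≔ v ]) ≡ ℤ.suc (offset k σ)
    offset-increases⁺ i v = step (offset k σ) (offset k (σ [ pos , i ≔ v ])) (balance-update⁺ (surplusOffset k) σ i v)

    offset-decreases⁺ : ∀ i v → surplusOffset k (pos , i) (σ (pos , i)) ≡ ℤ.suc (surplusOffset k (pos , i) v) →
      offset k σ ≡ ℤ.suc (offset k (σ [ pos , i ≔ v ]))
    offset-decreases⁺ i v = step (offset k (σ [ pos , i ≔ v ])) (offset k σ) (sym (balance-update⁺ (surplusOffset k) σ i v))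

    offset-increases⁻ : ∀ i v → surplusOffset k (neg , i) (σ (neg , i)) ≡ ℤ.suc (surplusOffset k (neg , i) v) →
      offset k (σ [ neg , i ≔ v ]) ≡ ℤ.suc (offset k σ)
    offset-increases⁻ i v = step (offset k σ) (offset k (σ [ neg , i ≔ v ])) (balance-update⁻ (surplusOffset k) σ i v)

    offset-decreases⁻ : ∀ i v → surplusOffset k (neg , i) v ≡ ℤ.suc (surplusOffset k (neg , i) (σ (neg , i))) →
      offset k σ ≡ ℤ.suc (offset k (σ [ neg , i ≔ v ]))
    offset-decreases⁻ i v = step (offset k (σ [ neg , i ≔ v ])) (offset k σ) (sym (balance-update⁻ (surplusOffset k) σ i v))

  -- Both requests stand on the same level `l`, so either both leave the surplus up to `k` or
  -- neither was in it; their signs are opposite and the changes cancel.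
  offset-match : ∀ k σ i j l v w → σ (pos , i) ≡ on l → σ (neg , j) ≡ on l →
    surplusOffset k (pos , i) v ≡ 0ℤ ℤ.- kept k (pos , i) → surplusOffset k (neg , j) w ≡ 0ℤ ℤ.- kept k (neg , j) →
    offset k (σ [ pos , i ≔ v ] [ neg , j ≔ w ]) ≡ offset k σ
  offset-match k σ i j l v w on₁ on₂ eq₁ eq₂ = begin
    d₂                            ≡⟨ S.solve 2 (λ d k → d S.:= (d S.:+ (S.con 0ℤ S.:- k)) S.:+ k) refl d₂ (kept k (neg , j)) ⟩
    (d₂ ℤ.+ (0ℤ ℤ.- kept k (neg , j))) ℤ.+ kept k (neg , j)
      ≡⟨ cong (ℤ._+ kept k (neg , j)) (begin
        d₂ ℤ.+ (0ℤ ℤ.- kept k (neg , j))   ≡⟨ cong (λ u → d₂ ℤ.+ u) eq₂ ⟨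
        d₂ ℤ.+ h (neg , j) w               ≡⟨ balance-update⁻ h σ₁ j w ⟩
        d₁ ℤ.+ h (neg , j) (σ₁ (neg , j))  ≡⟨ cong (λ u → d₁ ℤ.+ h (neg , j) u) (trans (update-other σ (pos , i) v λ ()) on₂) ⟩
        d₁ ℤ.+ (c ℤ.- kept k (neg , j))    ∎) ⟩
    (d₁ ℤ.+ (c ℤ.- kept k (neg , j))) ℤ.+ kept k (neg , j)
      ≡⟨ S.solve 4 (λ d c k l → (d S.:+ (c S.:- k)) S.:+ k S.:= ((d S.:+ (c S.:- l)) S.:+ l)) refl d₁ c (kept k (neg , j)) (kept k (pos , i)) ⟩
    (d₁ ℤ.+ (c ℤ.- kept k (pos , i))) ℤ.+ kept k (pos , i)
      ≡⟨ cong (ℤ._+ kept k (pos , i)) (begin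
        d₁ ℤ.+ (c ℤ.- kept k (pos , i))    ≡⟨ cong (λ u → d₁ ℤ.+ h (pos , i) u) on₁ ⟨
        d₁ ℤ.+ h (pos , i) (σ (pos , i))   ≡⟨ balance-update⁺ h σ i v ⟩
        d ℤ.+ h (pos , i) v                ≡⟨ cong (λ u → d ℤ.+ u) eq₁ ⟩
        d ℤ.+ (0ℤ ℤ.- kept k (pos , i))    ∎) ⟩
    (d ℤ.+ (0ℤ ℤ.- kept k (pos , i))) ℤ.+ kept k (pos , i)
      ≡⟨ S.solve 2 (λ d k → (d S.:+ (S.con 0ℤ S.:- k)) S.:+ k S.:= d) refl d (kept k (pos , i)) ⟩
    d                             ∎
    where
    open ≡-Reasoning
    module S = +-*-Solver
    h  = surplusOffset k
    σ₁ = σ [ pos , i ≔ v ]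
    d  = offset k σ
    d₁ = offset k σ₁
    d₂ = offset k (σ₁ [ neg , j ≔ w ])
    c  = upTo k l

  -- Here `a` is the accrued charge: what a step adds to it must be released by the excesses of the
  -- levels. Every kind of step is reduced to this with its own amount `c`.
  potential-bound : ∀ K {a a′ c} g g′ → a′ ≤ a + c → Σ< K g′ + c ≤ Σ< K g → a + Σ< K g ≤ 0# → a′ + Σ< K g′ ≤ 0#
  potential-bound K {a} {a′} {c} g g′ a≤ g≤ ≤0 = ≤-trans
    (≤-by (+-mono-≤ a≤ g≤) (solve 5 (λ a a′ g g′ c → (a :+ g) :- (a′ :+ g′) := ((a :+ c) :+ g) :- (a′ :+ (g′ :+ c)))
      refl a a′ (Σ< K g) (Σ< K g′) c)) ≤0

  Σ<-decrease : ∀ K {g g′ c k} → k ℕ.< K → (∀ j → j ≢ k → g′ j ≤ g j) → g′ k + c ≤ g k → Σ< K g′ + c ≤ Σ< K g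
  Σ<-decrease (suc K) {g} {g′} {c} {k} k<1+K others at with K ℕ.≟ k
  ... | yes refl = ≤-by (+-mono-≤ (Σ<-mono K (λ j j<K → others j (ℕ.<⇒≢ j<K))) at)
        (solve 5 (λ S S′ a a′ c → (S :+ a) :- ((S′ :+ a′) :+ c) := (S :+ a) :- (S′ :+ (a′ :+ c))) refl
          (Σ< K g) (Σ< K g′) (g K) (g′ K) c)
  ... | no K≢k = ≤-by (+-mono-≤ (Σ<-decrease K (ℕ.≤∧≢⇒< (ℕ.s≤s⁻¹ k<1+K) (K≢k ∘ sym)) others at) (others K K≢k))
        (solve 5 (λ S S′ a a′ c → (S :+ a) :- ((S′ :+ a′) :+ c) := (S :+ a) :- ((S′ :+ c) :+ a′)) refl
          (Σ< K g) (Σ< K g′) (g K) (g′ K) c)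

  total-update-≤ : ∀ (h : Request → Status → ℝ) σ r v {c} → h r v ≤ h r (σ r) + c →
    total (λ q → h q ((σ [ r ≔ v ]) q)) ≤ total (λ q → h q (σ q)) + c
  total-update-≤ h σ r v {c} hr≤ = ≤-by hr≤ (begin
    (T + c) - T′                                   ≡⟨ solve 4 (λ T T′ u c → (T :+ c) :- T′ := (T :+ (u :+ c)) :- (T′ :+ u)) refl T T′ (h r (σ r)) c ⟩
    (T + (h r (σ r) + c)) - (T′ + h r (σ r))       ≡⟨ cong (λ w → (T + (h r (σ r) + c)) - w) (total-update h σ r v) ⟩
    (T + (h r (σ r) + c)) - (T + h r v)            ≡⟨ solve 3 (λ T a b → (T :+ a) :- (T :+ b) := a :- b) refl T _ _ ⟩
    (h r (σ r) + c) - h r v                        ∎)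
    where
    open ≡-Reasoning
    T  = total (λ q → h q (σ q))
    T′ = total (λ q → h q ((σ [ r ≔ v ]) q))

-- Matches, moves and arrivals preserve the invariant.

module Discrete (R : RealNumbers) (F : Concave.ExpPiecewiseLinear R) (I : Concave.Instance R)
               (π : Permutation′ (Concave.Instance.m I)) where
  open RealNumbers R
  open Real R
  open Sums R
  open Potential R
  open PiecewiseLinear R F
  open Concave R
  open ExpPiecewiseLinear F
  open Instance I
  open BPSLA F I
  open State
  open Offsets R F I π

  update-elim : ∀ {ℓ} (P : Request → Status → Set ℓ) σ r v → P r v → (∀ q → P q (σ q)) → ∀ q → P q ((σ [ r ≔ v ]) q)
  update-elim P σ r v at others q with q ≟ᵣ r
  ... | yes refl = at
  ... | no  _    = others q

  Pending Started : ℝ → Request → Status → Set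
  Pending t r v = v ≡ unarrived → t ≤ arrival r
  Started t r v = v ≢ unarrived → arrival r ≤ t

  Level< : ℕ → Request → Status → Set
  Level< K r v = ∀ k → v ≡ on k → k ℕ.< K

  on≢unarrived : ∀ {v k} → v ≡ on k → v ≢ unarrived
  on≢unarrived refl ()

  module _ {M : ℕ} (pM : IsPiece extent M) where
    private
      K = suc M

      piece : ∀ {k} → k ℕ.< K → IsPiece extent k
      piece k<K = IsPiece-mono extent (ℕ.s≤s⁻¹ k<K) pM

    match-invariant : ∀ {s i j} k → status s (pos , i) ≡ on k → status s (neg , j) ≡ on k → Invariant K s →
      Invariant K ⟨ now s , status s [ pos , i ≔ matched j (now s) ] [ neg , j ≔ matched i (now s) ] , counter s ⟩
    match-invariant {s} {i} {j} k on₁ on₂ inv = record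
      { pending = update-elim (Pending t) σ₁ _ _ (λ ()) (update-elim (Pending t) σ _ _ (λ ()) pending)
      ; started = update-elim (Started t) σ₁ _ _ (λ _ → a≤ on₂) (update-elim (Started t) σ _ _ (λ _ → a≤ on₁) started)
      ; levels  = update-elim (Level< K) σ₁ _ _ (λ _ ()) (update-elim (Level< K) σ _ _ (λ _ ()) levels)
      ; nonNeg  = nonNeg
      ; capped  = capped
      ; last    = λ l ¬next → trans (same-offset l) (last l ¬next)
      ; bounded = potential-bound K (λ l → excess l s) (λ l → excess l s′)
          (≤-trans (total-update-≤ (accrued t) σ₁ (neg , j) (matched i t)
                     (subst (λ u → f (t - arrival (neg , j)) ≤ accrued t (neg , j) u + 0#)
                       (sym (trans (update-other σ (pos , i) (matched j t) λ ()) on₂)) (settle on₂)))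
            (≤-trans (≤-reflexive (+-identityʳ _))
              (total-update-≤ (accrued t) σ (pos , i) (matched j t)
                (subst (λ u → f (t - arrival (pos , i)) ≤ accrued t (pos , i) u + 0#) (sym on₁) (settle on₁)))))
          (≤-reflexive (trans (+-identityʳ _) (Σ<-cong K (λ l _ → same-excess l))))
          bounded
      }
      where
      open Invariant inv
      t  = now s
      σ  = status s
      σ₁ = σ [ pos , i ≔ matched j t ]
      σ₂ = σ₁ [ neg , j ≔ matched i t ]
      s′ : State
      s′ = ⟨ t , σ₂ , counter s ⟩
      a≤ : ∀ {r} → σ r ≡ on k → arrival r ≤ t
      a≤ {r} on-k = started r (on≢unarrived on-k)
      -- A match replaces the charge along the line by the true value of `f`, which is no larger.
      settle : ∀ {r} → σ r ≡ on k → f (t - arrival r) ≤ (Σ< k y + α k * (t - arrival r)) + 0#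
      settle {r} on-k = ≤-trans (f≤tangent k (t - arrival r) (piece (levels r k on-k)) (≤⇒0≤ (a≤ on-k)))
        (≤-reflexive (sym (+-identityʳ _)))
      same-offset : ∀ l → offset l σ₂ ≡ offset l σ
      same-offset l = offset-match l σ i j k (matched j t) (matched i t) on₁ on₂ refl refl
      same-drop : ∀ l → total (λ r → dropCost l r (σ₂ r)) ≡ total (λ r → dropCost l r (σ r))
      same-drop l = trans
        (total-cong (update-invariant (dropCost l) σ₁ (neg , j) (matched i t)
          (sym (cong (dropCost l (neg , j)) (trans (update-other σ (pos , i) (matched j t) λ ()) on₂)))))
        (total-cong (update-invariant (dropCost l) σ (pos , i) (matched j t) (sym (cong (dropCost l (pos , i)) on₁))))
      same-excess : ∀ l → excess l s′ ≡ excess l s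
      same-excess l = cong₂ (λ d c → Ψ (y l) d (counter s pos l) (counter s neg l) - (fromℕ 14 * sum (keepCost l t) + fromℕ 7 * c))
        (same-offset l) (same-drop l)

    -- The slope decreases, so the charge of the moved request rises by at most `y k`, and `Ψ` at
    -- level `k` releases that much. At any other level `l` the request counts towards the surplus
    -- either both before and after the move or not at all.
    move-invariant : ∀ {s p i} k → Full s p k → status s (p , i) ≡ on k → suc k ℕ.< K → Invariant K s →
      Invariant K ⟨ now s , status s [ p , i ≔ on (suc k) ] , reset k (counter s) ⟩
    move-invariant {s} {p} {i} k (hk , full) on-k 1+k<K inv = record
      { pending = update-elim (Pending t) σ _ _ (λ ()) pending
      ; started = update-elim (Started t) σ _ _ (λ _ → a≤t) started
      ; levels  = update-elim (Level< K) σ _ _ (λ { _ refl → 1+k<K }) levels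
      ; nonNeg  = λ q l l<K → reset-elim (0# ≤_) q l ≤-refl (nonNeg q l l<K)
      ; capped  = λ q l hl → reset-elim (_≤ y l) q l (0≤y hl) (capped q l hl)
      -- Only the offset at `k` changes, and a full counter has a next piece.
      ; last    = λ l ¬next → trans (same-offset l (λ { refl → ¬next hk })) (last l ¬next)
      ; bounded = potential-bound K (λ l → excess l s) (λ l → excess l s′)
          (total-update-≤ (accrued t) σ r (on (suc k))
            (subst (λ u → accrued t r (on (suc k)) ≤ accrued t r u + y k) (sym on-k) pay))
          (Σ<-decrease K (ℕ.<⇒≤ 1+k<K) (λ l l≢k → ≤-reflexive (same-excess l l≢k)) at-k)
          bounded
      }
      where
      open Invariant inv
      r  = p , i
      t  = now s
      σ  = status s
      z  = counter s
      σ′ = σ [ r ≔ on (suc k) ]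
      s′ : State
      s′ = ⟨ t , σ′ , reset k z ⟩
      k<K = ℕ.<⇒≤ 1+k<K
      a≤t : arrival r ≤ t
      a≤t = started r (on≢unarrived on-k)
      reset-elim : (P : ℝ → Set) → ∀ q l → P 0# → P (z q l) → P (reset k z q l)
      reset-elim P q l with does (l ℕ.≟ k)
      ... | true  = λ p _ → p
      ... | false = λ _ p → p
      pay : Σ< (suc k) y + α (suc k) * (t - arrival r) ≤ (Σ< k y + α k * (t - arrival r)) + y k
      pay = ≤-by (*-monoʳ-≤ (≤⇒0≤ a≤t) (α-antitone k (piece 1+k<K)))
        (solve 4 (λ S y u v → ((S :+ u) :+ y) :- ((S :+ y) :+ v) := u :- v) refl (Σ< k y) (y k) (α k * (t - arrival r)) _)
      same-offset : ∀ l → l ≢ k → offset l σ′ ≡ offset l σ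
      same-offset l l≢k = offset-unchanged l σ r (on (suc k))
        (trans (cong (ℤ._- kept l r) (upTo-suc l≢k)) (sym (cong (surplusOffset l r) on-k)))
      same-drop : ∀ l → total (λ r → dropCost l r (σ′ r)) ≡ total (λ r → dropCost l r (σ r))
      same-drop l = total-cong (update-invariant (dropCost l) σ r (on (suc k)) (sym (cong (dropCost l r) on-k)))
      reset-other : ∀ q l → l ≢ k → reset k z q l ≡ z q l
      reset-other q l l≢k rewrite dec-false (l ℕ.≟ k) l≢k = refl
      reset-self : ∀ q → reset k z q k ≡ 0#
      reset-self q rewrite dec-true (k ℕ.≟ k) refl = refl
      cost′ : ∀ l → referenceCost l t σ′ ≡ referenceCost l t σ
      cost′ l = cong (λ c → fromℕ 14 * sum (keepCost l t) + fromℕ 7 * c) (same-drop l)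
      same-excess : ∀ l → l ≢ k → excess l s′ ≡ excess l s
      same-excess l l≢k = cong₂ _-_
        (trans (cong₂ (Ψ (y l) (offset l σ′)) (reset-other pos l l≢k) (reset-other neg l l≢k))
          (cong (λ d → Ψ (y l) d (z pos l) (z neg l)) (same-offset l l≢k))) (cost′ l)
      moved : ∀ q → surplusOffset k q (on k) ≡ ℤ.suc (surplusOffset k q (on (suc k)))
      moved q = trans (cong (ℤ._- kept k q) (upTo-self k))
        (trans (ℤ.+-assoc 1ℤ 0ℤ (ℤ.- kept k q)) (sym (cong (λ v → ℤ.suc (v ℤ.- kept k q)) (upTo-self-suc k))))
      before : surplusOffset k r (σ r) ≡ ℤ.suc (surplusOffset k r (on (suc k)))
      before = trans (cong (surplusOffset k r) on-k) (moved r)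
      Ψ-falls : ∀ p → (p , i) ≡ r → Ψ (y k) (offset k σ′) 0# 0# + y k ≤ Ψ (y k) (offset k σ) (z pos k) (z neg k)
      Ψ-falls pos refl = subst₂ (λ d u → Ψ (y k) (offset k σ′) 0# 0# + y k ≤ Ψ (y k) d u (z neg k))
        (sym (offset-decreases⁺ k σ i (on (suc k)) before)) (sym full)
        (Ψ-reset⁺ (offset k σ′) (0≤y hk) (nonNeg neg k k<K) (capped neg k hk))
      Ψ-falls neg refl = subst₂ (λ d u → Ψ (y k) d 0# 0# + y k ≤ Ψ (y k) (offset k σ) (z pos k) u)
        (sym (offset-increases⁻ k σ i (on (suc k)) before)) (sym full)
        (Ψ-reset⁻ (offset k σ) (0≤y hk) (nonNeg pos k k<K) (capped pos k hk))
      at-k : excess k s′ + y k ≤ excess k s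
      at-k = subst (λ e → e + y k ≤ excess k s)
        (sym (cong₂ _-_ (cong₂ (Ψ (y k) (offset k σ′)) (reset-self pos) (reset-self neg)) (cost′ k)))
        (≤-by (Ψ-falls p refl) (solve 4 (λ a b y c → (b :- c) :- ((a :- c) :+ y) := b :- (a :+ y)) refl
          (Ψ (y k) (offset k σ′) 0# 0#) (Ψ (y k) (offset k σ) (z pos k) (z neg k)) (y k) (referenceCost k t σ)))

    -- At a level that keeps the pair, both surpluses change alike. At a level that drops it, the
    -- offset moves by one and `Ψ` rises by at most 7 `y l`, which is the charge added for the drop.
    arrive-invariant : ∀ {s r} → status s r ≡ unarrived → arrival r ≡ now s → Invariant K s →
      Invariant K ⟨ now s , status s [ r ≔ on 0 ] , counter s ⟩
    arrive-invariant {s} {r} new a≡t inv = record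
      { pending = update-elim (Pending t) σ _ _ (λ ()) pending
      ; started = update-elim (Started t) σ _ _ (λ _ → ≤-reflexive a≡t) started
      ; levels  = update-elim (Level< K) σ _ _ (λ { _ refl → ℕ.z<s }) levels
      ; nonNeg  = nonNeg
      ; capped  = capped
      -- A level without a next piece has no long pairs, so the arrival is kept there.
      ; last    = λ l ¬next → trans (kept-offset l (kept-short l (¬next ∘ proj₁))) (last l ¬next)
      ; bounded = potential-bound K (λ l → excess l s) (λ l → excess l s′)
          (total-update-≤ (accrued t) σ r (on 0)
            (subst (λ u → accrued t r (on 0) ≤ accrued t r u + 0#) (sym new) (≤-reflexive (trans
              (cong (λ a → 0# + α 0 * (t - a)) a≡t) (solve 2 (λ a t → κ 0 :+ a :* (t :- t) := κ 0 :+ κ 0) refl (α 0) t)))))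
          (≤-trans (≤-reflexive (+-identityʳ _)) (Σ<-mono K at-level))
          bounded
      }
      where
      open Invariant inv
      t  = now s
      σ  = status s
      z  = counter s
      σ′ = σ [ r ≔ on 0 ]
      s′ : State
      s′ = ⟨ t , σ′ , z ⟩
      drop drop′ : ℕ → ℝ
      drop l = total (λ r → dropCost l r (σ r))
      drop′ l = total (λ r → dropCost l r (σ′ r))
      Longᵣ : ℕ → Set
      Longᵣ l = Long l (gap (pairOf r))
      kept-short : ∀ l → ¬ Longᵣ l → kept l r ≡ 1ℤ
      kept-short l ¬long = cong (λ b → if b then 0ℤ else 1ℤ) (dec-false (long? l (gap (pairOf r))) ¬long)
      kept-long : ∀ l → Longᵣ l → kept l r ≡ 0ℤ
      kept-long l long = cong (λ b → if b then 0ℤ else 1ℤ) (dec-true (long? l (gap (pairOf r))) long)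
      drop-grows : ∀ l → drop′ l ≡ drop l + dropCost l r (on 0)
      drop-grows l = trans (sym (+-identityʳ _))
        (trans (cong (λ v → drop′ l + dropCost l r v) (sym new)) (total-update (dropCost l) σ r (on 0)))
      kept-offset : ∀ l → kept l r ≡ 1ℤ → offset l σ′ ≡ offset l σ
      kept-offset l kept≡1 = offset-unchanged l σ r (on 0)
        (trans (cong (λ κᵣ → 1ℤ ℤ.- κᵣ) kept≡1) (sym (cong (surplusOffset l r) new)))
      dropped : ∀ l → kept l r ≡ 0ℤ → surplusOffset l r (on 0) ≡ ℤ.suc (surplusOffset l r (σ r))
      dropped l kept≡0 = trans (cong (λ κᵣ → 1ℤ ℤ.- κᵣ) kept≡0) (sym (cong (ℤ.suc ∘ surplusOffset l r) new))
      Ψ-rises : ∀ l q → (q , proj₂ r) ≡ r → l ℕ.< K → HasNext extent l → kept l r ≡ 0ℤ →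
        Ψ (y l) (offset l σ′) (z pos l) (z neg l) ≤ Ψ (y l) (offset l σ) (z pos l) (z neg l) + fromℕ 7 * y l
      Ψ-rises l pos refl l<K hl kept≡0 = subst
        (λ d → Ψ (y l) d (z pos l) (z neg l) ≤ Ψ (y l) (offset l σ) (z pos l) (z neg l) + fromℕ 7 * y l)
        (sym (offset-increases⁺ l σ (proj₂ r) (on 0) (dropped l kept≡0)))
        (Ψ-suc (offset l σ) (0≤y hl) (nonNeg pos l l<K) (capped neg l hl))
      Ψ-rises l neg refl l<K hl kept≡0 = subst
        (λ d → Ψ (y l) (offset l σ′) (z pos l) (z neg l) ≤ Ψ (y l) d (z pos l) (z neg l) + fromℕ 7 * y l)
        (sym (offset-decreases⁻ l σ (proj₂ r) (on 0) (dropped l kept≡0)))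
        (Ψ-pred (offset l σ′) (0≤y hl) (nonNeg neg l l<K) (capped pos l hl))
      at-level : ∀ l → l ℕ.< K → excess l s′ ≤ excess l s
      at-level l l<K with long? l (gap (pairOf r))
      ... | yes long@(hl , _) = ≤-by (Ψ-rises l (proj₁ r) refl l<K hl (kept-long l long)) (trans
              (cong (λ d → (P - (c + fromℕ 7 * drop l)) - (P′ - (c + fromℕ 7 * d)))
                (trans (drop-grows l) (cong (λ b → drop l + (if b then y l else 0#)) (dec-true (long? l (gap (pairOf r))) long))))
              (solve 5 (λ P P′ c d y → (P :- (c :+ κ 7 :* d)) :- (P′ :- (c :+ κ 7 :* (d :+ y))) := (P :+ κ 7 :* y) :- P′) refl
                P P′ c (drop l) (y l)))
        where
        P = Ψ (y l) (offset l σ) (z pos l) (z neg l)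
        P′ = Ψ (y l) (offset l σ′) (z pos l) (z neg l)
        c = fromℕ 14 * sum (keepCost l t)
      ... | no ¬long = ≤-reflexive (cong₂ (λ d c → Ψ (y l) d (z pos l) (z neg l) - (fromℕ 14 * sum (keepCost l t) + fromℕ 7 * c))
              (kept-offset l (kept-short l ¬long))
              (trans (drop-grows l) (trans (cong (λ b → drop l + (if b then y l else 0#))
                (dec-false (long? l (gap (pairOf r))) ¬long)) (+-identityʳ _))))

+-sum : ∀ {n} (g : Fin n → ℕ) → ℤ.+ (CommutativeMonoidSum.sum ℕ.+-0-commutativeMonoid g)
          ≡ CommutativeMonoidSum.sum ℤ.+-0-commutativeMonoid (λ i → ℤ.+ g i)
+-sum {zero}  g = refl
+-sum {suc n} g = cong (λ j → ℤ.+ g zero ℤ.+ j) (+-sum (g ∘ suc))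

-- The passage of time preserves the invariant.

module Elapse (R : RealNumbers) (F : Concave.ExpPiecewiseLinear R) (I : Concave.Instance R)
               (π : Permutation′ (Concave.Instance.m I)) where
  open RealNumbers R
  open Real R
  open Sums R
  open Potential R
  open PiecewiseLinear R F
  open Concave R
  open ExpPiecewiseLinear F
  open Instance I
  open BPSLA F I
  open State
  open Offsets R F I π
  open Discrete R F I π
  private module S = +-*-Solver

  spread-comm : ∀ t a b → spread t a b ≡ spread t b a
  spread-comm t a b = begin
    (u - v) ⊔ - (u - v)  ≡⟨ ⊔-comm (u - v) (- (u - v)) ⟩
    - (u - v) ⊔ (u - v)  ≡⟨ cong₂ _⊔_ (flip u v) (sym (flip v u)) ⟩
    (v - u) ⊔ - (v - u)  ∎
    where
    open ≡-Reasoning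
    u = t ⊓ a
    v = t ⊓ b
    flip : ∀ u v → - (u - v) ≡ v - u
    flip = solve 2 (λ u v → :- (u :- v) := v :- u) refl

  spread-before : ∀ {t a b} → t ≤ a → t ≤ b → spread t a b ≡ 0#
  spread-before {t} {a} {b} t≤a t≤b = trans
    (cong₂ (λ u v → ∣ u - v ∣ᵣ) (x≤y⇒x⊓y≈x t≤a) (x≤y⇒x⊓y≈x t≤b))
    (trans (cong ∣_∣ᵣ (-‿inverseʳ t)) (trans (x≤y⇒x⊔y≈y (≤-reflexive 0≡-0)) (sym 0≡-0)))
    where
    0≡-0 : 0# ≡ - 0#
    0≡-0 = solve 0 (κ 0 := :- κ 0) refl

  spread-after : ∀ {t a b} → a ≤ t → b ≤ t → spread t a b ≡ ∣ a - b ∣ᵣ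
  spread-after a≤t b≤t = cong₂ (λ u v → ∣ u - v ∣ᵣ) (x≤y⇒y⊓x≈x a≤t) (x≤y⇒y⊓x≈x b≤t)

  spread-between : ∀ {t a b} → a ≤ t → t ≤ b → spread t a b ≡ t - a
  spread-between {t} {a} {b} a≤t t≤b = trans
    (cong₂ (λ u v → ∣ u - v ∣ᵣ) (x≤y⇒y⊓x≈x a≤t) (x≤y⇒x⊓y≈x t≤b))
    (trans (x≤y⇒x⊔y≈y (≤-by (+-mono-≤ a≤t a≤t)
      (solve 2 (λ a t → (:- (a :- t)) :- (a :- t) := (t :+ t) :- (a :+ a)) refl a t)))
      (solve 2 (λ a t → :- (a :- t) := t :- a) refl a t))

  sumℤ-distrib-minus : ∀ {n} (g h : Fin n → ℤ) → sumℤ (λ i → g i ℤ.- h i) ≡ sumℤ g ℤ.- sumℤ h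
  sumℤ-distrib-minus {zero}  g h = refl
  sumℤ-distrib-minus {suc n} g h = trans (cong (λ v → (g zero ℤ.- h zero) ℤ.+ v) (sumℤ-distrib-minus (g ∘ suc) (h ∘ suc)))
    (S.solve 4 (λ a b c d → (a S.:- b) S.:+ (c S.:- d) S.:= (a S.:+ c) S.:- (b S.:+ d)) refl
      (g zero) (h zero) (sumℤ (g ∘ suc)) (sumℤ (h ∘ suc)))

  ∣sumℤ∣≤sum∣∣ : ∀ {n} (g : Fin n → ℤ) → fromℕ ∣ sumℤ g ∣ ≤ sum (λ i → fromℕ ∣ g i ∣)
  ∣sumℤ∣≤sum∣∣ {zero}  g = ≤-refl
  ∣sumℤ∣≤sum∣∣ {suc n} g = ≤-trans (fromℕ-mono-≤ (ℤ.∣i+j∣≤∣i∣+∣j∣ (g zero) (sumℤ (g ∘ suc))))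
    (≤-trans (≤-reflexive (fromℕ-+ ∣ g zero ∣ _)) (+-monoʳ-≤ _ (∣sumℤ∣≤sum∣∣ (g ∘ suc))))

  onUpTo-zero : ∀ v → onUpTo 0 v ≡ ℤ.+ indicator 0 v
  onUpTo-zero unarrived      = refl
  onUpTo-zero (on zero)      = refl
  onUpTo-zero (on (suc j))   = refl
  onUpTo-zero (matched _ _)  = refl

  onUpTo-suc : ∀ k v → onUpTo (suc k) v ≡ onUpTo k v ℤ.+ ℤ.+ indicator (suc k) v
  onUpTo-suc k unarrived     = refl
  onUpTo-suc k (matched _ _) = refl
  onUpTo-suc k (on j) with ℕ.<-cmp j (suc k)
  ... | tri< j<1+k j≢1+k _
    rewrite dec-true (j ℕ.≤? suc k) (ℕ.<⇒≤ j<1+k) | dec-true (j ℕ.≤? k) (ℕ.s≤s⁻¹ j<1+k) | dec-false (j ℕ.≟ suc k) j≢1+k = refl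
  ... | tri≈ _ refl _
    rewrite dec-true (suc k ℕ.≤? suc k) ℕ.≤-refl | dec-false (suc k ℕ.≤? k) (ℕ.<-irrefl refl) | dec-true (suc k ℕ.≟ suc k) refl = refl
  ... | tri> _ j≢1+k j>1+k
    rewrite dec-false (j ℕ.≤? suc k) (ℕ.<⇒≱ j>1+k) | dec-false (j ℕ.≤? k) (ℕ.<⇒≱ (ℕ.<⇒≤ j>1+k)) | dec-false (j ℕ.≟ suc k) j≢1+k = refl

  number-difference : ∀ s k → number s pos k ⊖ number s neg k ≡ balance (λ r → ℤ.+ indicator k (status s r))
  number-difference s k = trans (sym (ℤ.m-n≡m⊖n (number s pos k) (number s neg k)))
    (cong₂ ℤ._-_ (+-sum (λ i → indicator k (status s (pos , i)))) (+-sum (λ i → indicator k (status s (neg , i)))))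

  surplus≡balance : ∀ s k → surplus s k ≡ balance (λ r → onUpTo k (status s r))
  surplus≡balance s zero    = trans (number-difference s 0) (balance-cong (λ r → sym (onUpTo-zero (status s r))))
  surplus≡balance s (suc k) = begin
    surplus s k ℤ.+ (number s pos (suc k) ⊖ number s neg (suc k))
      ≡⟨ cong₂ ℤ._+_ (surplus≡balance s k) (number-difference s (suc k)) ⟩
    balance (λ r → onUpTo k (status s r)) ℤ.+ balance (λ r → ℤ.+ indicator (suc k) (status s r))
      ≡⟨ balance-distrib-+ (λ r → onUpTo k (status s r)) (λ r → ℤ.+ indicator (suc k) (status s r)) ⟨
    balance (λ r → onUpTo k (status s r) ℤ.+ ℤ.+ indicator (suc k) (status s r))
      ≡⟨ balance-cong (λ r → sym (onUpTo-suc k (status s r))) ⟩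
    balance (λ r → onUpTo (suc k) (status s r))  ∎
    where open ≡-Reasoning

  surplus≡offset+reference : ∀ s k → surplus s k ≡ offset k (status s) ℤ.+ reference k (status s)
  surplus≡offset+reference s k = trans (surplus≡balance s k) (trans
    (balance-cong (λ r → S.solve 2 (λ u v → u S.:= (u S.:- v) S.:+ v) refl (onUpTo k (status s r)) (keptArrived k r (status s r))))
    (balance-distrib-+ (λ r → surplusOffset k r (status s r)) (λ r → keptArrived k r (status s r))))

  on? : ∀ v k → Dec (v ≡ on k)
  on? unarrived     k = no λ ()
  on? (matched _ _) k = no λ ()
  on? (on j)        k with j ℕ.≟ k
  ... | yes refl = yes refl
  ... | no  j≢k  = no λ { refl → j≢k refl }

  indicator-off : ∀ k v → v ≢ on k → indicator k v ≡ 0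
  indicator-off k unarrived     _ = refl
  indicator-off k (matched _ _) _ = refl
  indicator-off k (on j)        v≢ rewrite dec-false (j ℕ.≟ k) (v≢ ∘ cong on) = refl

  none⇒number≡0 : ∀ s p k → ¬ (∃ λ i → status s (p , i) ≡ on k) → number s p k ≡ 0
  none⇒number≡0 s p k none = trans
    (CommutativeMonoidSum.sum-cong-≗ ℕ.+-0-commutativeMonoid (λ i → indicator-off k _ (λ e → none (i , e))))
    (CommutativeMonoidSum.sum-replicate-zero ℕ.+-0-commutativeMonoid m)

  occupied? : ∀ s p k → Dec (∃ λ i → status s (p , i) ≡ on k)
  occupied? s p k = Fin.any? (λ i → on? (status s (p , i)) k)

  one-sided : ∀ s k → NoPair s → number s pos k ≡ 0 ⊎ number s neg k ≡ 0
  one-sided s k noPair with occupied? s pos k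
  ... | no none       = inj₁ (none⇒number≡0 s pos k none)
  ... | yes (i , on₁) = inj₂ (none⇒number≡0 s neg k λ { (j , on₂) → noPair k i j (on₁ , on₂) })

  fromℕ-sum : ∀ {n} (g : Fin n → ℕ) → fromℕ (CommutativeMonoidSum.sum ℕ.+-0-commutativeMonoid g) ≡ sum (λ i → fromℕ (g i))
  fromℕ-sum {zero}  g = refl
  fromℕ-sum {suc n} g = trans (fromℕ-+ (g zero) _) (cong (λ v → fromℕ (g zero) + v) (fromℕ-sum (g ∘ suc)))

  Σ<-indicator-off : ∀ K (β : ℕ → ℝ) v → (∀ k → k ℕ.< K → v ≢ on k) → Σ< K (λ k → β k * fromℕ (indicator k v)) ≡ 0#
  Σ<-indicator-off K β v off = Σ<-zero K λ k k<K →
    trans (cong (λ n → β k * fromℕ n) (indicator-off k v (off k k<K))) (zeroʳ (β k))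

  Σ<-indicator-on : ∀ K (β : ℕ → ℝ) {j} → j ℕ.< K → Σ< K (λ k → β k * fromℕ (indicator k (on j))) ≡ β j
  Σ<-indicator-on (suc K) β {j} j<1+K with j ℕ.≟ K
  ... | yes refl = trans (cong₂ _+_ (Σ<-indicator-off K β (on j) (λ { k k<K refl → ℕ.<-irrefl refl k<K }))
            (trans (cong (λ b → β K * fromℕ (if b then 1 else 0)) (dec-true (K ℕ.≟ K) refl))
              (solve 1 (λ b → b :* κ 1 := b) refl (β K)))) (+-identityˡ (β K))
  ... | no j≢K = trans (cong₂ _+_ (Σ<-indicator-on K β (ℕ.≤∧≢⇒< (ℕ.s≤s⁻¹ j<1+K) j≢K))
            (trans (cong (λ b → β K * fromℕ (if b then 1 else 0)) (dec-false (j ℕ.≟ K) j≢K)) (zeroʳ (β K)))) (+-identityʳ (β j))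

  module _ {M : ℕ} (pM : IsPiece extent M) {s : State} {δ : ℝ} {z : Sign → ℕ → ℝ}
           (noPair : NoPair s) (0<δ : 0# < δ)
           (quiet : ∀ r → status s r ≡ unarrived → now s + δ ≤ arrival r)
           (grow : ∀ p k → Increasing s p k → z p k ≡ counter s p k + α k * fromℕ ∣ surplus s k ∣ * δ)
           (stay : ∀ p k → ¬ Increasing s p k → z p k ≡ counter s p k)
           (fits : ∀ p k → HasNext extent k → z p k ≤ y k)
           (inv : Invariant (suc M) s) where
    open Invariant inv
    private
      K = suc M
      t = now s
      t′ = t + δ
      σ = status s
      c = counter s
      s′ : State
      s′ = ⟨ t′ , σ , z ⟩
      0≤δ = <⇒≤ 0<δ

      piece : ∀ {k} → k ℕ.< K → IsPiece extent k
      piece k<K = IsPiece-mono extent (ℕ.s≤s⁻¹ k<K) pM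

      β gain : ℕ → ℝ
      β k = α k * δ
      gain k = (z pos k - c pos k) + (z neg k - c neg k)

      0≤β : ∀ {k} → k ℕ.< K → 0# ≤ β k
      0≤β k<K = *-nonNeg (0≤α (piece k<K)) 0≤δ

      t≤t′ : t ≤ t′
      t≤t′ = ≤-by 0≤δ (solve 2 (λ t d → (t :+ d) :- t := d :- κ 0) refl t δ)

      speed : ℕ → ℝ
      speed k = β k * fromℕ ∣ surplus s k ∣

      previous : ℕ → ℤ
      previous zero    = 0ℤ
      previous (suc k) = surplus s k

      surplus-step : ∀ k → surplus s k ≡ previous k ℤ.+ (number s pos k ⊖ number s neg k)
      surplus-step zero    = sym (ℤ.+-identityˡ _)
      surplus-step (suc k) = refl

      -- In the case `flat` the surplus is zero or no request of its polarity waits on level `k`. In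
      -- the latter case the level itself contributes nothing of that sign, so the surplus is
      -- inherited from the levels below; this gives the bound by `previous k`.
      data Growth (k : ℕ) : Set where
        up   : 0ℤ ℤ.< surplus s k → z pos k ≡ c pos k + speed k → z neg k ≡ c neg k → Growth k
        down : surplus s k ℤ.< 0ℤ → z pos k ≡ c pos k → z neg k ≡ c neg k + speed k → Growth k
        flat : ∣ surplus s k ∣ ℕ.≤ ∣ previous k ∣ → z pos k ≡ c pos k → z neg k ≡ c neg k → Growth k

      grown : ∀ p k → Increasing s p k → z p k ≡ c p k + speed k
      grown p k inc = trans (grow p k inc) (cong (λ v → c p k + v)
        (solve 3 (λ a n d → a :* n :* d := a :* d :* n) refl (α k) (fromℕ ∣ surplus s k ∣) δ))

      growth : ∀ k → Growth k
      growth k with ℤ.<-cmp (surplus s k) 0ℤ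
      growth k | tri≈ ≮ ≡0 ≯ = flat (subst (ℕ._≤ ∣ previous k ∣) (sym (cong ∣_∣ ≡0)) ℕ.z≤n)
        (stay pos k (λ inc → ≯ (proj₂ inc))) (stay neg k (λ inc → ≮ (proj₂ inc)))
      growth k | tri> ≮ _ >0 with occupied? s pos k
      ... | yes occ = up >0 (grown pos k (occ , >0)) (stay neg k (λ inc → ≮ (proj₂ inc)))
      ... | no none = flat (∣∣-mono-nonNeg (ℤ.<⇒≤ >0) S≤) (stay pos k (none ∘ proj₁)) (stay neg k (λ inc → ≮ (proj₂ inc)))
        where
        S≤ : surplus s k ℤ.≤ previous k
        S≤ = begin
          surplus s k                             ≡⟨ surplus-step k ⟩
          previous k ℤ.+ (number s pos k ⊖ number s neg k)  ≡⟨ cong (λ n → previous k ℤ.+ (n ⊖ number s neg k)) (none⇒number≡0 s pos k none) ⟩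
          previous k ℤ.+ (0 ⊖ number s neg k)     ≤⟨ ℤ.+-monoʳ-≤ (previous k) (ℤ.⊖-monoʳ-≥-≤ 0 (ℕ.z≤n {number s neg k})) ⟩
          previous k ℤ.+ 0ℤ                       ≡⟨ ℤ.+-identityʳ _ ⟩
          previous k                              ∎
          where open ℤ.≤-Reasoning
      growth k | tri< <0 _ ≯ with occupied? s neg k
      ... | yes occ = down <0 (stay pos k (λ inc → ≯ (proj₂ inc))) (grown neg k (occ , <0))
      ... | no none = flat (subst₂ ℕ._≤_ (ℤ.∣-i∣≡∣i∣ (surplus s k)) (ℤ.∣-i∣≡∣i∣ (previous k))
              (∣∣-mono-nonNeg (ℤ.neg-mono-≤ (ℤ.<⇒≤ <0)) (ℤ.neg-mono-≤ ≤S)))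
              (stay pos k (λ inc → ≯ (proj₂ inc))) (stay neg k (none ∘ proj₁))
        where
        ≤S : previous k ℤ.≤ surplus s k
        ≤S = begin
          previous k                              ≡⟨ ℤ.+-identityʳ _ ⟨
          previous k ℤ.+ 0ℤ                       ≤⟨ ℤ.+-monoʳ-≤ (previous k) (ℤ.+≤+ (ℕ.z≤n {number s pos k})) ⟩
          previous k ℤ.+ (number s pos k ⊖ 0)     ≡⟨ cong (λ n → previous k ℤ.+ (number s pos k ⊖ n)) (none⇒number≡0 s neg k none) ⟨
          previous k ℤ.+ (number s pos k ⊖ number s neg k)  ≡⟨ surplus-step k ⟨
          surplus s k                             ∎
          where open ℤ.≤-Reasoning

      0≤speed : ∀ {k} → k ℕ.< K → 0# ≤ speed k
      0≤speed {k} k<K = *-nonNeg (0≤β k<K) (0≤fromℕ ∣ surplus s k ∣)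

      grow-nonNeg : ∀ p k → k ℕ.< K → 0# ≤ z p k
      grow-nonNeg p k k<K with growth k
      grow-nonNeg pos k k<K | up _ e₁ e₂ = subst (0# ≤_) (sym e₁) (+-nonNeg (nonNeg pos k k<K) (0≤speed k<K))
      grow-nonNeg neg k k<K | up _ e₁ e₂ = subst (0# ≤_) (sym e₂) (nonNeg neg k k<K)
      grow-nonNeg pos k k<K | down _ e₁ e₂ = subst (0# ≤_) (sym e₁) (nonNeg pos k k<K)
      grow-nonNeg neg k k<K | down _ e₁ e₂ = subst (0# ≤_) (sym e₂) (+-nonNeg (nonNeg neg k k<K) (0≤speed k<K))
      grow-nonNeg pos k k<K | flat _ e₁ e₂ = subst (0# ≤_) (sym e₁) (nonNeg pos k k<K)
      grow-nonNeg neg k k<K | flat _ e₁ e₂ = subst (0# ≤_) (sym e₂) (nonNeg neg k k<K)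

      speed≤gain : ∀ k → k ℕ.< K → speed k ≤ gain k + β k * fromℕ ∣ previous k ∣
      speed≤gain k k<K with growth k
      ... | up _ e₁ e₂ rewrite e₁ | e₂ = ≤-by (*-nonNeg (0≤β k<K) (0≤fromℕ ∣ previous k ∣))
              (solve 4 (λ u v e w → ((((u :+ e) :- u) :+ (v :- v)) :+ w) :- e := w :- κ 0) refl (c pos k) (c neg k) (speed k) _)
      ... | down _ e₁ e₂ rewrite e₁ | e₂ = ≤-by (*-nonNeg (0≤β k<K) (0≤fromℕ ∣ previous k ∣))
              (solve 4 (λ u v e w → (((u :- u) :+ ((v :+ e) :- v)) :+ w) :- e := w :- κ 0) refl (c pos k) (c neg k) (speed k) _)
      ... | flat S≤ e₁ e₂ rewrite e₁ | e₂ = ≤-by (*-monoˡ-≤ (0≤β k<K) (fromℕ-mono-≤ S≤))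
              (solve 4 (λ u v e w → (((u :- u) :+ (v :- v)) :+ w) :- e := w :- e) refl (c pos k) (c neg k) (speed k) _)

      waiting : ℕ → ℕ
      waiting k = number s pos k ℕ.+ number s neg k

      ∣difference∣≡waiting : ∀ k → ∣ number s pos k ⊖ number s neg k ∣ ≡ waiting k
      ∣difference∣≡waiting k = ⊖-one-sided (one-sided s k noPair)

      -- As `NoPair` leaves at most one polarity on a level, the number waiting there is the
      -- absolute difference of two consecutive surpluses.
      waiting-suc : ∀ k → waiting (suc k) ℕ.≤ ∣ surplus s (suc k) ∣ ℕ.+ ∣ surplus s k ∣
      waiting-suc k = subst (ℕ._≤ ∣ surplus s (suc k) ∣ ℕ.+ ∣ surplus s k ∣)
        (trans (cong ∣_∣ (S.solve 2 (λ u v → (u S.:+ v) S.:- u S.:= v) refl (surplus s k) _)) (∣difference∣≡waiting (suc k)))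
        (ℤ.∣i-j∣≤∣i∣+∣j∣ (surplus s (suc k)) (surplus s k))

      delay≤gain : Σ< K (λ k → β k * fromℕ (waiting k)) ≤ fromℕ 3 * Σ< K gain
      delay≤gain = waiting≤growth β gain (surplus s) waiting M
        (λ k k≤M → 0≤β (ℕ.s≤s k≤M))
        (λ k k<M → ≤-trans (≤-reflexive (solve 2 (λ a d → a :* d :+ a :* d := (a :+ a) :* d) refl (α (suc k)) δ))
          (*-monoʳ-≤ 0≤δ (α-double k (piece (ℕ.s≤s k<M)))))
        (ℕ.≤-reflexive (sym (∣difference∣≡waiting 0))) waiting-suc
        (≤-trans (speed≤gain 0 ℕ.z<s) (≤-reflexive (solve 2 (λ g b → g :+ b :* κ 0 := g) refl (gain 0) (β 0))))
        (λ k k<M → speed≤gain (suc k) (ℕ.s≤s k<M))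

      accrued-grows : ∀ r → accrued t′ r (σ r) ≡ accrued t r (σ r) + Σ< K (λ k → β k * fromℕ (indicator k (σ r)))
      accrued-grows r with σ r in eq
      ... | unarrived   = sym (trans (+-identityˡ _) (Σ<-indicator-off K β unarrived (λ _ _ ())))
      ... | matched j u = sym (trans (cong (λ v → f (u - arrival r) + v) (Σ<-indicator-off K β (matched j u) (λ _ _ ()))) (+-identityʳ _))
      ... | on k        = trans (solve 5 (λ S a t d b → S :+ a :* ((t :+ d) :- b) := (S :+ a :* (t :- b)) :+ a :* d) refl
              (Σ< k y) (α k) t δ (arrival r)) (cong (λ v → (Σ< k y + α k * (t - arrival r)) + v) (sym (Σ<-indicator-on K β (levels r k eq))))

      occupancy : ∀ p → sum (λ i → Σ< K (λ k → β k * fromℕ (indicator k (σ (p , i))))) ≡ Σ< K (λ k → β k * fromℕ (number s p k))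
      occupancy p = trans (sym (Σ<-sum-comm K (λ k i → β k * fromℕ (indicator k (σ (p , i))))))
        (Σ<-cong K (λ k _ → trans (sym (*-distribˡ-sum (β k) (λ i → fromℕ (indicator k (σ (p , i))))))
          (cong (λ v → β k * v) (sym (fromℕ-sum (λ i → indicator k (σ (p , i))))))))

      totalAccrued-grows : totalAccrued s′ ≡ totalAccrued s + Σ< K (λ k → β k * fromℕ (waiting k))
      totalAccrued-grows = begin
        total (λ r → accrued t′ r (σ r))
          ≡⟨ cong₂ _+_ (part pos) (part neg) ⟩
        (P + Σ< K (λ k → β k * fromℕ (number s pos k))) + (N + Σ< K (λ k → β k * fromℕ (number s neg k)))
          ≡⟨ solve 4 (λ p a n b → (p :+ a) :+ (n :+ b) := (p :+ n) :+ (a :+ b)) refl P _ N _ ⟩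
        (P + N) + (Σ< K (λ k → β k * fromℕ (number s pos k)) + Σ< K (λ k → β k * fromℕ (number s neg k)))
          ≡⟨ cong (λ v → (P + N) + v) (trans (sym (Σ<-distrib-+ K _ _)) (Σ<-cong K (λ k _ →
               trans (sym (distribˡ (β k) _ _)) (cong (λ v → β k * v) (sym (fromℕ-+ (number s pos k) (number s neg k))))))) ⟩
        (P + N) + Σ< K (λ k → β k * fromℕ (waiting k))  ∎
        where
        open ≡-Reasoning
        P = sum (λ i → accrued t (pos , i) (σ (pos , i)))
        N = sum (λ i → accrued t (neg , i) (σ (neg , i)))
        part : ∀ p → sum (λ i → accrued t′ (p , i) (σ (p , i)))
                 ≡ sum (λ i → accrued t (p , i) (σ (p , i))) + Σ< K (λ k → β k * fromℕ (number s p k))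
        part p = trans (sum-cong (λ i → accrued-grows (p , i)))
          (trans (sum-distrib-+ (λ i → accrued t (p , i) (σ (p , i))) (λ i → Σ< K (λ k → β k * fromℕ (indicator k (σ (p , i))))))
            (cong (λ v → sum (λ i → accrued t (p , i) (σ (p , i))) + v) (occupancy p)))

      -- No arrival lies strictly between `t` and `t′`, so each request is either present throughout
      -- the interval or absent throughout.
      phase : ∀ k r → (keptArrived k r (σ r) ≡ 0ℤ × t′ ≤ arrival r) ⊎ (keptArrived k r (σ r) ≡ kept k r × arrival r ≤ t)
      phase k r with σ r in eq
      ... | unarrived   = inj₁ (refl , quiet r eq)
      ... | on j        = inj₂ (refl , started r (λ e → on≢unarrived eq e))
      ... | matched j u = inj₂ (refl , started r (λ e → contradiction (trans (sym eq) e) λ ()))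

      imbalance : ℕ → Fin m → ℤ
      imbalance k i = keptArrived k (pos , i) (σ (pos , i)) ℤ.- keptArrived k (neg , π ⟨$⟩ʳ i) (σ (neg , π ⟨$⟩ʳ i))

      -- A kept pair is unbalanced when exactly one of its requests has arrived, and exactly then
      -- its `spread` grows by `δ`. A long pair has neither imbalance nor keeping cost.
      keepCost-grows : ∀ k → k ℕ.< K → ∀ i → β k * fromℕ ∣ imbalance k i ∣ + keepCost k t i ≤ keepCost k t′ i
      keepCost-grows k k<K i = by-phase (phase k (pos , i)) (phase k (neg , π ⟨$⟩ʳ i))
        where
        a = arrival (pos , i)
        b = arrival (neg , π ⟨$⟩ʳ i)
        A = keptArrived k (pos , i) (σ (pos , i))
        B = keptArrived k (neg , π ⟨$⟩ʳ i) (σ (neg , π ⟨$⟩ʳ i))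
        L = isLong k i
        Goal : Set
        Goal = β k * fromℕ ∣ A ℤ.- B ∣ + keepCost k t i ≤ keepCost k t′ i
        same-kept : kept k (neg , π ⟨$⟩ʳ i) ≡ (if L then 0ℤ else 1ℤ)
        same-kept = cong (λ j → if isLong k j then 0ℤ else 1ℤ) (inverseˡ π)
        none : β k * fromℕ 0 + keepCost k t i ≡ keepCost k t i
        none = solve 2 (λ b c → b :* κ 0 :+ c := c) refl (β k) (keepCost k t i)
        steady : ∣ A ℤ.- B ∣ ≡ 0 → spread t a b ≡ spread t′ a b → Goal
        steady AB≡0 eq = ≤-reflexive (trans (cong (λ n → β k * fromℕ n + keepCost k t i) AB≡0) (trans none
          (cong (λ d → if L then 0# else α k * d) eq)))
        waits : ∣ A ℤ.- B ∣ ≡ (if L then 0 else 1) → spread t a b + δ ≡ spread t′ a b → Goal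
        waits eq grows with L
        ... | true  = ≤-reflexive (trans (cong (λ n → β k * fromℕ n + 0#) eq) (solve 1 (λ b → b :* κ 0 :+ κ 0 := κ 0) refl (β k)))
        ... | false = ≤-reflexive (trans (cong (λ n → β k * fromℕ n + α k * spread t a b) eq)
                (trans (solve 3 (λ a d w → a :* d :* κ 1 :+ a :* w := a :* (w :+ d)) refl (α k) δ (spread t a b)) (cong (λ d → α k * d) grows)))
        one : ∀ {v} → v ≡ (if L then 0ℤ else 1ℤ) → ∣ v ∣ ≡ (if L then 0 else 1)
        one refl with L
        ... | true  = refl
        ... | false = refl
        between : ∀ {a b} → a ≤ t → t′ ≤ b → spread t a b + δ ≡ spread t′ a b
        between {a} {b} a≤t t′≤b = trans (cong (λ v → v + δ) (spread-between a≤t (≤-trans t≤t′ t′≤b)))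
          (trans (solve 3 (λ t a d → (t :- a) :+ d := (t :+ d) :- a) refl t a δ) (sym (spread-between (≤-trans a≤t t≤t′) t′≤b)))
        by-phase : (A ≡ 0ℤ × t′ ≤ a) ⊎ (A ≡ kept k (pos , i) × a ≤ t) →
                   (B ≡ 0ℤ × t′ ≤ b) ⊎ (B ≡ kept k (neg , π ⟨$⟩ʳ i) × b ≤ t) → Goal
        by-phase (inj₁ (A≡ , t′≤a)) (inj₁ (B≡ , t′≤b)) = steady (cong₂ (λ u v → ∣ u ℤ.- v ∣) A≡ B≡)
          (trans (spread-before (≤-trans t≤t′ t′≤a) (≤-trans t≤t′ t′≤b)) (sym (spread-before t′≤a t′≤b)))
        by-phase (inj₁ (A≡ , t′≤a)) (inj₂ (B≡ , b≤t)) = waits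
          (trans (cong₂ (λ u v → ∣ u ℤ.- v ∣) A≡ B≡) (trans (cong ∣_∣ (ℤ.+-identityˡ (ℤ.- kept k (neg , π ⟨$⟩ʳ i)))) (trans (ℤ.∣-i∣≡∣i∣ (kept k (neg , π ⟨$⟩ʳ i))) (one same-kept))))
          (trans (cong (λ v → v + δ) (spread-comm t a b)) (trans (between b≤t t′≤a) (spread-comm t′ b a)))
        by-phase (inj₂ (A≡ , a≤t)) (inj₁ (B≡ , t′≤b)) = waits
          (trans (cong₂ (λ u v → ∣ u ℤ.- v ∣) A≡ B≡) (trans (cong ∣_∣ (ℤ.+-identityʳ (kept k (pos , i)))) (one {kept k (pos , i)} refl)))
          (between a≤t t′≤b)
        by-phase (inj₂ (A≡ , a≤t)) (inj₂ (B≡ , b≤t)) = steady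
          (trans (cong₂ (λ u v → ∣ u ℤ.- v ∣) A≡ (trans B≡ same-kept)) (cong ∣_∣ (ℤ.+-inverseʳ (kept k (pos , i)))))
          (trans (spread-after a≤t b≤t) (sym (spread-after (≤-trans a≤t t≤t′) (≤-trans b≤t t≤t′))))

      reference≡imbalance : ∀ k → reference k σ ≡ sumℤ (imbalance k)
      reference≡imbalance k = trans
        (cong (λ v → sumℤ (λ i → keptArrived k (pos , i) (σ (pos , i))) ℤ.- v)
          (sumℤ-permute (λ j → keptArrived k (neg , j) (σ (neg , j))) π))
        (sym (sumℤ-distrib-minus (λ i → keptArrived k (pos , i) (σ (pos , i))) (λ i → keptArrived k (neg , π ⟨$⟩ʳ i) (σ (neg , π ⟨$⟩ʳ i)))))

      -- Grouping the negative requests by `π` turns the reference surplus into a sum over pairs, so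
      -- the unbalanced kept pairs, each paying at rate `α k`, cover its absolute value.
      reference-pays : ∀ k → k ℕ.< K → β k * fromℕ ∣ reference k σ ∣ + sum (keepCost k t) ≤ sum (keepCost k t′)
      reference-pays k k<K = ≤-trans
        (+-mono-≤ (≤-trans (*-monoˡ-≤ (0≤β k<K) (≤-trans (≤-reflexive (cong (λ i → fromℕ ∣ i ∣) (reference≡imbalance k)))
            (∣sumℤ∣≤sum∣∣ (imbalance k))))
          (≤-reflexive (*-distribˡ-sum (β k) (λ i → fromℕ ∣ imbalance k i ∣)))) ≤-refl)
        (≤-trans (≤-reflexive (sym (sum-distrib-+ (λ i → β k * fromℕ ∣ imbalance k i ∣) (keepCost k t))))
          (sum-mono (keepCost-grows k k<K)))

      Ψ-grows : ∀ k → k ℕ.< K → Ψ (y k) (offset k σ) (z pos k) (z neg k) + fromℕ 3 * gain k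
                  ≤ Ψ (y k) (offset k σ) (c pos k) (c neg k) + fromℕ 14 * (β k * fromℕ ∣ reference k σ ∣)
      Ψ-grows k k<K with growth k
      ... | up S>0 e₁ e₂ rewrite e₁ | e₂ = ≤-by
              (Ψ-grow⁺ (y k) (offset k σ) (surplus s k) (reference k σ) {β k} {c pos k} {c neg k} (0≤β k<K) S>0 (surplus≡offset+reference s k))
              (solve 5 (λ u v e p q → q :- (p :+ κ 3 :* (((u :+ e) :- u) :+ (v :- v))) := q :- (p :+ κ 3 :* e)) refl
                (c pos k) (c neg k) (speed k) (Ψ (y k) (offset k σ) (c pos k + speed k) (c neg k)) _)
      ... | down S<0 e₁ e₂ rewrite e₁ | e₂ = ≤-by
              (Ψ-grow⁻ (y k) (offset k σ) (surplus s k) (reference k σ) {β k} {c pos k} {c neg k} (0≤β k<K) S<0 (surplus≡offset+reference s k))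
              (solve 5 (λ u v e p q → q :- (p :+ κ 3 :* ((u :- u) :+ ((v :+ e) :- v))) := q :- (p :+ κ 3 :* e)) refl
                (c pos k) (c neg k) (speed k) (Ψ (y k) (offset k σ) (c pos k) (c neg k + speed k)) _)
      ... | flat _ e₁ e₂ rewrite e₁ | e₂ = ≤-by (0≤n* 14 (*-nonNeg (0≤β k<K) (0≤fromℕ ∣ reference k σ ∣)))
              (solve 4 (λ u v p q → (p :+ q) :- (p :+ κ 3 :* ((u :- u) :+ (v :- v))) := q :- κ 0) refl
                (c pos k) (c neg k) (Ψ (y k) (offset k σ) (c pos k) (c neg k)) _)

      at-level : ∀ k → k ℕ.< K → excess k s′ + fromℕ 3 * gain k ≤ excess k s
      at-level k k<K = ≤-by (+-mono-≤ (Ψ-grows k k<K) (*-monoˡ-≤ (0≤fromℕ 14) (reference-pays k k<K)))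
        (solve 7 (λ p p′ g w S S′ D → (p :- (κ 14 :* S :+ D)) :- ((p′ :- (κ 14 :* S′ :+ D)) :+ g)
          := ((p :+ κ 14 :* w) :+ κ 14 :* S′) :- ((p′ :+ g) :+ κ 14 :* (w :+ S))) refl
          (Ψ (y k) (offset k σ) (c pos k) (c neg k)) (Ψ (y k) (offset k σ) (z pos k) (z neg k)) (fromℕ 3 * gain k)
          (β k * fromℕ ∣ reference k σ ∣) (sum (keepCost k t)) (sum (keepCost k t′)) (fromℕ 7 * total (λ r → dropCost k r (σ r))))

    -- The waiting requests accrue at most 3 times the total growth of the counters, and the excess
    -- of each level falls by 3 times its own growth.
    elapse-invariant : Invariant K s′
    elapse-invariant = record
      { pending = quiet
      ; started = λ r arrived → ≤-trans (started r arrived) t≤t′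
      ; levels  = levels
      ; nonNeg  = grow-nonNeg
      ; capped  = fits
      ; last    = last
      ; bounded = potential-bound K (λ k → excess k s) (λ k → excess k s′) (≤-reflexive totalAccrued-grows)
          (≤-trans (+-monoʳ-≤ _ delay≤gain) (≤-trans (≤-reflexive (trans (cong (λ v → Σ< K (λ k → excess k s′) + v) (*-distribˡ-Σ< (fromℕ 3) K gain))
              (sym (Σ<-distrib-+ K (λ k → excess k s′) (λ k → fromℕ 3 * gain k)))))
            (Σ<-mono K at-level)))
          bounded
      }

-- Whole runs and the bound at their end.

module Conclusion (R : RealNumbers) (F : Concave.ExpPiecewiseLinear R) (I : Concave.Instance R)
               (π : Permutation′ (Concave.Instance.m I)) where
  open RealNumbers R
  open Real R
  open Sums R
  open Potential R
  open PiecewiseLinear R F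
  open Concave R
  open ExpPiecewiseLinear F
  open Instance I
  open BPSLA F I
  open State
  open Offsets R F I π
  open Discrete R F I π
  open Elapse R F I π

  sum-zero : ∀ n → sum {n} (λ _ → 0#) ≡ 0#
  sum-zero = CommutativeMonoidSum.sum-replicate-zero +-commutativeMonoid

  total-zero : total (λ _ → 0#) ≡ 0#
  total-zero = trans (cong₂ _+_ (sum-zero m) (sum-zero m)) (+-identityˡ 0#)

  initial-invariant : ∀ K → Invariant K initial
  initial-invariant K = record
    { pending = λ r _ → arrival-nonNeg r
    ; started = λ r arrived → contradiction refl arrived
    ; levels  = λ _ _ ()
    ; nonNeg  = λ _ _ _ → ≤-refl
    ; capped  = λ _ _ → 0≤y
    ; last    = λ k _ → no-offset k
    ; bounded = ≤-reflexive (trans (cong₂ _+_ total-zero (Σ<-zero K (λ k _ → no-excess k))) (+-identityˡ 0#))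
    }
    where
    no-offset : ∀ k → offset k (status initial) ≡ 0ℤ
    no-offset k = trans (cong (λ v → v ℤ.- v) (CommutativeMonoidSum.sum-replicate-zero ℤ.+-0-commutativeMonoid m)) refl
    no-keepCost : ∀ k i → keepCost k 0# i ≡ 0#
    no-keepCost k i with isLong k i
    ... | true  = refl
    ... | false = trans (cong (λ d → α k * d) (spread-before (arrival-nonNeg _) (arrival-nonNeg _))) (zeroʳ (α k))
    no-excess : ∀ k → excess k initial ≡ 0#
    no-excess k = trans (cong₂ (λ d c → Ψ (y k) d 0# 0# - c) (no-offset k)
        (cong₂ (λ u v → fromℕ 14 * u + fromℕ 7 * v) (trans (sum-cong (no-keepCost k)) (sum-zero m)) total-zero))
      (solve 1 (λ y → (κ 4 :* (y :* κ 0) :+ (κ 8 :* κ 0 :+ κ 8 :* κ 0)) :- (κ 14 :* κ 0 :+ κ 7 :* κ 0) := κ 0) refl (y k))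

  reached : ∀ {s s′} → s ⟶ s′ → ℕ
  reached (move k _ _ _) = suc k
  reached _              = 0

  -- The invariant uses one `K` along the whole run, so the deepest level is determined beforehand.
  -- It is a piece of `f`, which makes the slopes of all levels considered positive and halving.
  maxReached : ∀ {s s′} → Star _⟶_ s s′ → ℕ
  maxReached Star.ε           = 0
  maxReached (st ◅ path) = reached st ℕ.⊔ maxReached path

  reached-piece : ∀ {s s′} (st : s ⟶ s′) → IsPiece extent (reached st)
  reached-piece (match _ _ _)            = IsPiece-zero extent
  reached-piece (move k _ (hk , _) _)    = HasNext⇒IsPiece-suc extent hk
  reached-piece (arrive _ _ _ _)         = IsPiece-zero extent
  reached-piece (elapse _ _ _ _ _ _ _ _ _) = IsPiece-zero extent

  maxReached-piece : ∀ {s s′} (path : Star _⟶_ s s′) → IsPiece extent (maxReached path)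
  maxReached-piece Star.ε           = IsPiece-zero extent
  maxReached-piece (st ◅ path) with ℕ.⊔-sel (reached st) (maxReached path)
  ... | inj₁ e = subst (IsPiece extent) (sym e) (reached-piece st)
  ... | inj₂ e = subst (IsPiece extent) (sym e) (maxReached-piece path)

  0≤gap : ∀ i → 0# ≤ gap i
  0≤gap i with ≤-total 0# (arrival (pos , i) - arrival (neg , π ⟨$⟩ʳ i))
  ... | inj₁ 0≤d = ≤-trans 0≤d (x≤x⊔y _ _)
  ... | inj₂ d≤0 = ≤-trans (≤-by d≤0 (solve 1 (λ d → :- d :- κ 0 := κ 0 :- d) refl _)) (x≤y⊔x _ _)

  module _ {M : ℕ} (pM : IsPiece extent M) where
    step-invariant : ∀ {s s′} (st : s ⟶ s′) → reached st ℕ.≤ M → Invariant (suc M) s → Invariant (suc M) s′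
    step-invariant (match k on₁ on₂)          _   = match-invariant pM k on₁ on₂
    step-invariant (move k _ full on-k)       r≤M = move-invariant pM k full on-k (ℕ.s≤s r≤M)
    step-invariant (arrive _ _ new a≡t)       _   = arrive-invariant pM new a≡t
    step-invariant (elapse δ z noPair _ 0<δ quiet grow stay fits) _ =
      elapse-invariant pM noPair 0<δ quiet grow stay fits

    run-invariant : ∀ {s s′} (path : Star _⟶_ s s′) → maxReached path ℕ.≤ M → Invariant (suc M) s → Invariant (suc M) s′
    run-invariant Star.ε           _  inv = inv
    run-invariant (st ◅ path) ≤M inv = run-invariant path (ℕ.m⊔n≤o⇒n≤o _ _ ≤M)
      (step-invariant st (ℕ.m⊔n≤o⇒m≤o (reached st) _ ≤M) inv)

    -- As `Ψ` is nonnegative, the accrued charge is at most the reference cost of all levels. When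
    -- all requests have arrived, that cost is 14 times the sum of the shares, and the shares of a
    -- pair add up to at most 3 `f` of its gap.
    final-bound : ∀ {s} → Invariant (suc M) s → (∀ r → status s r ≢ unarrived) →
      totalAccrued s ≤ fromℕ 42 * sum (λ i → f (gap i))
    final-bound {s} inv arrived = ≤-by
      (+-mono-≤ bounded (≤-trans (Σ<-mono K reference≤) (≤-trans
        (≤-reflexive (trans (sym (*-distribˡ-Σ< (fromℕ 14) K (λ k → sum (λ i → share k (gap i))))) (cong (λ v → fromℕ 14 * v) (Σ<-sum-comm K (λ k i → share k (gap i))))))
        (*-monoˡ-≤ (0≤fromℕ 14) (≤-trans (sum-mono (λ i → Σshare≤3f (0≤gap i) M pM))
          (≤-reflexive (sym (*-distribˡ-sum (fromℕ 3) (λ i → f (gap i))))))))))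
      (trans (solve 2 (λ T G → κ 42 :* G :- T := κ 14 :* (κ 3 :* G) :- T) refl (totalAccrued s) G)
        (trans (solve 3 (λ T G E → κ 14 :* (κ 3 :* G) :- T := (κ 0 :+ κ 14 :* (κ 3 :* G)) :- ((T :+ E) :+ :- E)) refl (totalAccrued s) G E)
          (cong (λ e → (0# + fromℕ 14 * (fromℕ 3 * G)) - ((totalAccrued s + E) + e)) negE)))
      where
      open Invariant inv
      K = suc M
      t = now s
      σ = status s
      G = sum (λ i → f (gap i))
      E = Σ< K (λ k → excess k s)
      negE : - E ≡ Σ< K (λ k → - excess k s)
      negE = trans (solve 1 (λ e → :- e := :- κ 1 :* e) refl E) (trans (*-distribˡ-Σ< (- fromℕ 1) K (λ k → excess k s))
        (Σ<-cong K (λ k _ → solve 1 (λ e → :- κ 1 :* e := :- e) refl (excess k s))))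
      a≤t : ∀ r → arrival r ≤ t
      a≤t r = started r (arrived r)
      0≤Ψ : ∀ k → k ℕ.< K → 0# ≤ Ψ (y k) (offset k σ) (counter s pos k) (counter s neg k)
      0≤Ψ k k<K with hasNext? extent k
      ... | yes hk  = Ψ-nonNeg (offset k σ) (0≤y hk) (nonNeg pos k k<K) (capped pos k hk) (nonNeg neg k k<K) (capped neg k hk)
      -- Without a capacity the counters are unbounded, but at offset zero both weights are 8.
      ... | no ¬hk  = subst (λ d → 0# ≤ Ψ (y k) d (counter s pos k) (counter s neg k)) (sym (last k ¬hk))
                        (Ψ-zero-nonNeg (y k) (nonNeg pos k k<K) (nonNeg neg k k<K))
      drop : ℕ → Fin m → ℝ
      drop k i = if isLong k i then y k else 0#
      dropCost≡ : ∀ k r → dropCost k r (σ r) ≡ drop k (pairOf r)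
      dropCost≡ k r with σ r in eq
      ... | unarrived   = contradiction eq (arrived r)
      ... | on _        = refl
      ... | matched _ _ = refl
      drops : ∀ k → total (λ r → dropCost k r (σ r)) ≡ sum (λ i → drop k i + drop k i)
      drops k = trans (total-cong (dropCost≡ k)) (trans
        (cong (λ v → sum (drop k) + v) (trans (CommutativeMonoidSum.sum-permute +-commutativeMonoid (λ j → drop k (π ⟨$⟩ˡ j)) π)
          (sum-cong {n = m} {λ i → drop k (π ⟨$⟩ˡ (π ⟨$⟩ʳ i))} {drop k} (λ i → cong (drop k) (inverseˡ π)))))
        (sym (sum-distrib-+ (drop k) (drop k))))
      pays : ∀ k i → fromℕ 14 * keepCost k t i + fromℕ 7 * (drop k i + drop k i) ≡ fromℕ 14 * share k (gap i)
      pays k i with isLong k i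
      ... | true  = solve 1 (λ y → κ 14 :* κ 0 :+ κ 7 :* (y :+ y) := κ 14 :* y) refl (y k)
      ... | false = trans (solve 1 (λ v → κ 14 :* v :+ κ 7 :* (κ 0 :+ κ 0) := κ 14 :* v) refl _)
                      (cong (λ d → fromℕ 14 * (α k * d)) (spread-after (a≤t _) (a≤t _)))
      reference≡ : ∀ k → referenceCost k t σ ≡ fromℕ 14 * sum (λ i → share k (gap i))
      reference≡ k = begin
        fromℕ 14 * sum (keepCost k t) + fromℕ 7 * total (λ r → dropCost k r (σ r))
          ≡⟨ cong₂ _+_ (*-distribˡ-sum (fromℕ 14) (keepCost k t))
               (trans (cong (λ v → fromℕ 7 * v) (drops k)) (*-distribˡ-sum (fromℕ 7) (λ i → drop k i + drop k i))) ⟩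
        sum (λ i → fromℕ 14 * keepCost k t i) + sum (λ i → fromℕ 7 * (drop k i + drop k i))
          ≡⟨ sum-distrib-+ (λ i → fromℕ 14 * keepCost k t i) (λ i → fromℕ 7 * (drop k i + drop k i)) ⟨
        sum (λ i → fromℕ 14 * keepCost k t i + fromℕ 7 * (drop k i + drop k i))
          ≡⟨ sum-cong (pays k) ⟩
        sum (λ i → fromℕ 14 * share k (gap i))
          ≡⟨ *-distribˡ-sum (fromℕ 14) (λ i → share k (gap i)) ⟨
        fromℕ 14 * sum (λ i → share k (gap i))  ∎
        where open ≡-Reasoning
      reference≤ : ∀ k → k ℕ.< K → - excess k s ≤ fromℕ 14 * sum (λ i → share k (gap i))
      reference≤ k k<K = ≤-by (0≤Ψ k k<K) (trans (cong (λ v → v - (- excess k s)) (sym (reference≡ k)))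
        (solve 2 (λ p c → c :- (:- (p :- c)) := p :- κ 0) refl
          (Ψ (y k) (offset k σ) (counter s pos k) (counter s neg k)) (referenceCost k t σ)))

-- From `f` to `D`, and comparison with the offline solution.

module Competitiveness (R : RealNumbers) where
  open RealNumbers R
  open Concave R
  open Real R
  open Sums R

  -- The reference pairing `π` is the partner permutation of `OPT`. The factor 84 combines 2 from
  -- `D ≤ 2 f` on the side of the algorithm with 42 from `final-bound`; the offline side uses
  -- `f ≤ D`.
  competitive : (D : ℝ → ℝ) → Admissible D → (F : ExpPiecewiseLinear) →
    (∀ t → 0# ≤ t → ExpPiecewiseLinear.f F t ≤ D t × D t ≤ 2# * ExpPiecewiseLinear.f F t) →
    (I : Instance) (ALG OPT : Solution I) → BPSLA.Produces F I ALG →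
    cost I D ALG ≤ fromℕ 84 * cost I D OPT
  competitive D admissible F f≤D≤2f I ALG OPT (s , path , pos-matched , neg-matched) =
    ≤-trans alg≤ (≤-trans (*-monoˡ-≤ (0≤fromℕ 2) (≤-trans alg-f≤ (*-monoˡ-≤ (0≤fromℕ 42) opt≥)))
      (≤-reflexive (solve 1 (λ c → κ 2 :* (κ 42 :* c) := κ 84 :* c) refl (cost I D OPT))))
    where
    open ExpPiecewiseLinear F using (f)
    open Admissible admissible
    open Instance I
    open BPSLA F I
    open State
    module Alg = Solution ALG
    module Opt = Solution OPT
    open Offsets R F I Opt.partner
    open Conclusion R F I Opt.partner
    pM = maxReached-piece path
    inv = run-invariant pM path ℕ.≤-refl (initial-invariant _)

    status-matched : ∀ r → ∃ λ j → status s r ≡ matched j (Alg.time r)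
    status-matched (pos , i) = _ , pos-matched i
    status-matched (neg , j) = i , subst (λ j → status s (neg , j) ≡ matched i (Alg.time (neg , j)))
      (inverseʳ Alg.partner) (neg-matched i)
      where i = Alg.partner ⟨$⟩ˡ j

    arrived : ∀ r → status s r ≢ unarrived
    arrived r e = contradiction (trans (sym (proj₂ (status-matched r))) e) λ ()

    alg-f : ℝ
    alg-f = total (λ r → f (Alg.time r - arrival r))

    alg-f≤ : alg-f ≤ fromℕ 42 * sum (λ i → f (gap i))
    -- All requests are matched at the end, so the accrued charge has become `f` of the actual
    -- delays.
    alg-f≤ = subst (_≤ fromℕ 42 * sum (λ i → f (gap i)))
      (total-cong (λ r → cong (accrued (now s) r) (proj₂ (status-matched r))))
      (final-bound pM inv arrived)

    alg≤ : cost I D ALG ≤ fromℕ 2 * alg-f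
    alg≤ = ≤-trans (+-mono-≤ (sum-mono (λ i → D≤ (pos , i))) (sum-mono (λ i → D≤ (neg , i))))
      (≤-reflexive (sym (trans (distribˡ _ _ _) (cong₂ _+_ (*-distribˡ-sum (fromℕ 2) (λ i → f (Alg.time (pos , i) - arrival (pos , i))))
        (*-distribˡ-sum (fromℕ 2) (λ i → f (Alg.time (neg , i) - arrival (neg , i))))))))
      where
      D≤ : ∀ r → D (Alg.time r - arrival r) ≤ fromℕ 2 * f (Alg.time r - arrival r)
      D≤ r = subst (λ c → D (Alg.time r - arrival r) ≤ c * f (Alg.time r - arrival r)) 2#≡fromℕ2
        (proj₂ (f≤D≤2f _ (≤⇒0≤ (Alg.causal r))))

    -- Both requests of a pair are matched at a common time, after both arrivals, so the earlier one
    -- has waited at least the gap and its delay alone pays for the pair.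
    opt≥ : sum (λ i → f (gap i)) ≤ cost I D OPT
    opt≥ = ≤-trans (sum-mono pair≥) (≤-reflexive (trans (sum-distrib-+ (λ i → delay (pos , i)) (λ i → delay (neg , Opt.partner ⟨$⟩ʳ i)))
      (cong (λ v → sum (λ i → delay (pos , i)) + v)
        (sym (CommutativeMonoidSum.sum-permute +-commutativeMonoid (λ j → delay (neg , j)) Opt.partner)))))
      where
      delay : Request → ℝ
      delay r = D (Opt.time r - arrival r)
      0≤delay : ∀ r → 0# ≤ delay r
      0≤delay r = nonNeg _ (≤⇒0≤ (Opt.causal r))
      f≤delay : ∀ {g} r → 0# ≤ g → g ≤ Opt.time r - arrival r → f g ≤ delay r
      f≤delay {g} r 0≤g g≤ = ≤-trans (proj₁ (f≤D≤2f g 0≤g)) (monotone g _ 0≤g g≤)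
      pair≥ : ∀ i → f (gap i) ≤ delay (pos , i) + delay (neg , Opt.partner ⟨$⟩ʳ i)
      pair≥ i with ≤-total (arrival (pos , i)) (arrival (neg , Opt.partner ⟨$⟩ʳ i))
      ... | inj₁ a≤b = ≤-trans (f≤delay (pos , i) (0≤gap i) (⊔-lub
              (≤-by (+-mono-≤ (Opt.causal (pos , i)) a≤b)
                (solve 3 (λ t a b → (t :- a) :- (a :- b) := (t :+ b) :- (a :+ a)) refl (Opt.time (pos , i)) a b))
              (≤-by (subst (b ≤_) (sym (Opt.together i)) (Opt.causal (neg , Opt.partner ⟨$⟩ʳ i)))
                (solve 3 (λ t a b → (t :- a) :- (:- (a :- b)) := t :- b) refl (Opt.time (pos , i)) a b))))
            (≤-by (0≤delay (neg , Opt.partner ⟨$⟩ʳ i)) (solve 2 (λ u v → (u :+ v) :- u := v :- κ 0) refl _ _))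
        where
        a = arrival (pos , i)
        b = arrival (neg , Opt.partner ⟨$⟩ʳ i)
      ... | inj₂ b≤a = ≤-trans (f≤delay (neg , Opt.partner ⟨$⟩ʳ i) (0≤gap i) (⊔-lub
              (≤-by (subst (a ≤_) (Opt.together i) (Opt.causal (pos , i)))
                (solve 3 (λ t a b → (t :- b) :- (a :- b) := t :- a) refl (Opt.time (neg , Opt.partner ⟨$⟩ʳ i)) a b))
              (≤-by (+-mono-≤ (Opt.causal (neg , Opt.partner ⟨$⟩ʳ i)) b≤a)
                (solve 3 (λ t a b → (t :- b) :- (:- (a :- b)) := (t :+ a) :- (b :+ b)) refl (Opt.time (neg , Opt.partner ⟨$⟩ʳ i)) a b))))
            (≤-by (0≤delay (pos , i)) (solve 2 (λ u v → (u :+ v) :- v := u :- κ 0) refl _ _))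
        where
        a = arrival (pos , i)
        b = arrival (neg , Opt.partner ⟨$⟩ʳ i)

theorem22 : (R : RealNumbers) →
    let open RealNumbers R
        open Concave R in
    ∃ λ (C : ℝ) →
      (D : ℝ → ℝ) → Admissible D →
      (F : ExpPiecewiseLinear) →
      (∀ t → 0# ≤ t →
        ExpPiecewiseLinear.f F t ≤ D t × D t ≤ 2# * ExpPiecewiseLinear.f F t) →
      (I : Instance) →
      (ALG OPT : Solution I) →
      BPSLA.Produces F I ALG →
      Optimal I D OPT →
      cost I D ALG ≤ C * cost I D OPT
theorem22 R = fromℕ 84 , λ D admissible F f≤D≤2f I ALG OPT produces _ →
  competitive D admissible F f≤D≤2f I ALG OPT produces
  where
  open RealNumbers R using (fromℕ)
  open Competitiveness R
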